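{- Let $p$ and $r$ be distinct prime numbers. Then: (i) $\Phi_p^{ -1}\bmod \Phi_1 = 1/p$, and $\Phi_1^{ -1}\bmod\Phi_p = -\frac{1}{p}\left(X^{p-2}+2X^{p-3}+\cdots+(p-2)X+(p-1)\right)$, i.e. $-\frac1p\sum_{k=0}^{p-2}(p-1-k)X^k$. (ii) $\Phi_{pr}^{ -1}\bmod\Phi_1 = 1$, and $\Phi_1^{ -1}\bmod\Phi_{pr}=\sum_{i=0}^{\varphi(pr)-1}v_iX^i$ with all $v_i\in\{ -1,0,1\}$. (iii) For every nonnegative integer $d$ with $d\equiv r-1 \pmod p$, one has $\Phi_{pr}\cdot\frac{1}{r}\sum_{i=0}^{d}X^i\equiv 1 \pmod{\Phi_p}$ in $\mathbb{Q}[X]$ (i.e. $\Phi_{pr}^{ -1}\bmod\Phi_p=\frac1r\sum_{i=0}^dX^i$); and $\Phi_p^{ -1}\bmod\Phi_{pr}=\frac{1}{r}\sum_{i=0}^{\varphi(pr)-1}v_iX^i$ where the $v_i$ are integers with $v_i<r$ for all $i$. (iv) $\Phi_p^{ -1}\bmod\Phi_r=\sum_{i=0}^{\varphi(r)-1}v_iX^i$ with all $v_i\in\{ -1,0,1\}$.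
   Context: For a positive integer $k$, $\Phi_k\in\mathbb{Z}[X]$ denotes the $k$-th cyclotomic polynomial (monic, of degree $\varphi(k)$, whose roots are the primitive $k$-th roots of unity); $\varphi$ is Euler's totient function. When $\Phi_m$ and $\Phi_n$ are coprime in $\mathbb{Q}[X]$, $\Phi_m^{ -1}\bmod\Phi_n$ denotes the unique polynomial $U\in\mathbb{Q}[X]$ with $\deg U<\varphi(n)$ such that $\Phi_m U\equiv 1\pmod{\Phi_n}$ (equivalently, $\Phi_mU+\Phi_nV=1$ for some $V\in\mathbb{Q}[X]$); in particular for $n=1$ it is a constant. -}

module Defs where

open import Data.Nat as ℕ using (ℕ; zero; suc; _∸_)
open import Data.Nat.Divisibility using (_∣?_)
open import Data.Nat.Coprimality using (coprime?)
open import Data.Integer as ℤ using (ℤ; +_)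
open import Data.Rational as ℚ using (ℚ; 0ℚ; 1ℚ; _/_)
open import Data.Rational.Properties using (_≟_)
open import Data.List using (List; []; _∷_; _++_; [_]; map; filter; length; reverse; foldr; replicate; dropWhile; upTo)
open import Data.Product using (_×_; _,_; proj₁; proj₂; ∃)
open import Relation.Binary.PropositionalEquality using (_≡_)

-- Polynomials in ℚ[X], as little-endian coefficient lists
-- (the list a₀ ∷ a₁ ∷ … represents a₀ + a₁ X + …; trailing zeros allowed).

Poly : Set
Poly = List ℚ

coeff : Poly → ℕ → ℚ
coeff []      _       = 0ℚ
coeff (a ∷ p) zero    = a
coeff (a ∷ p) (suc i) = coeff p i

infix 4 _≈ₚ_
_≈ₚ_ : Poly → Poly → Set
P ≈ₚ Q = ∀ i → coeff P i ≡ coeff Q i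

infixl 6 _+ₚ_ _-ₚ_
infixl 7 _*ₚ_

_+ₚ_ : Poly → Poly → Poly
[]      +ₚ q       = q
(a ∷ p) +ₚ []      = a ∷ p
(a ∷ p) +ₚ (b ∷ q) = (a ℚ.+ b) ∷ (p +ₚ q)

scaleₚ : ℚ → Poly → Poly
scaleₚ c p = map (c ℚ.*_) p

-ₚ_ : Poly → Poly
-ₚ p = map ℚ.-_ p

_-ₚ_ : Poly → Poly → Poly
p -ₚ q = p +ₚ (-ₚ q)

_*ₚ_ : Poly → Poly → Poly
[]      *ₚ q = []
(a ∷ p) *ₚ q = scaleₚ a q +ₚ (0ℚ ∷ (p *ₚ q))

constₚ : ℚ → Poly
constₚ c = c ∷ []

1ₚ : Poly
1ₚ = constₚ 1ℚ

X^ : ℕ → Poly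
X^ n = replicate n 0ℚ ++ [ 1ℚ ]

prodₚ : List Poly → Poly
prodₚ = foldr _*ₚ_ 1ₚ

-- Exact division by a monic polynomial (synthetic long division),
-- used only to define the cyclotomic polynomials.

private
  subPrefix : List ℚ → List ℚ → List ℚ
  subPrefix r       []      = r
  subPrefix []      (_ ∷ _) = []
  subPrefix (x ∷ r) (y ∷ s) = (x ℚ.- y) ∷ subPrefix r s

  -- k steps of long division of a big-endian remainder by the monic
  -- big-endian divisor 1 ∷ dt; returns the big-endian quotient
  divSteps : ℕ → List ℚ → List ℚ → List ℚ
  divSteps zero    r       dt = []
  divSteps (suc k) []      dt = []
  divSteps (suc k) (c ∷ r) dt = c ∷ divSteps k (subPrefix r (scaleₚ c dt)) dt

  bigEndian : Poly → List ℚ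
  bigEndian p = dropWhile (λ x → x ≟ 0ℚ) (reverse p)

-- quotient of p by a monic polynomial d
quotₚ : Poly → Poly → Poly
quotₚ p d with bigEndian d
... | []       = []
... | (_ ∷ dt) = reverse (divSteps (suc (length P) ∸ length (bigEndian d)) P dt)
  where P = bigEndian p

-- Cyclotomic polynomials, via the standard recursion
--   X^n - 1 = ∏_{d ∣ n} Φ_d ,  i.e.  Φ_n = (X^n - 1) / ∏_{d ∣ n, d < n} Φ_d .
-- cycloTable n = [(1 , Φ₁), (2 , Φ₂), … , (n , Φₙ)]

cycloTable : ℕ → List (ℕ × Poly)
cycloTable zero    = []
cycloTable (suc n) =
  t ++ [ (suc n , quotₚ (X^ (suc n) -ₚ 1ₚ)
                        (prodₚ (map proj₂ (filter (λ e → proj₁ e ∣? suc n) t)))) ]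
  where t = cycloTable n

private
  lastPoly : List (ℕ × Poly) → Poly
  lastPoly []            = 1ₚ
  lastPoly (e ∷ [])      = proj₂ e
  lastPoly (_ ∷ e ∷ es)  = lastPoly (e ∷ es)

-- Φ k (Φ 0 := 1 is an irrelevant convention)
Φ : ℕ → Poly
Φ n = lastPoly (cycloTable n)

φ : ℕ → ℕ
φ n = length (filter (λ k → coprime? k n) (map suc (upTo n)))

ℤ→ℚ : ℤ → ℚ
ℤ→ℚ z = z / 1

ℕ→ℚ : ℕ → ℚ
ℕ→ℚ n = + n / 1

recipℕ : ℕ → ℚ
recipℕ zero    = 0ℚ
recipℕ (suc n) = + 1 / suc n

InvCong : Poly → Poly → Poly → Set
InvCong A B U = ∃ λ V → A *ₚ U +ₚ B *ₚ V ≈ₚ 1ₚ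

DegLt : Poly → ℕ → Set
DegLt U k = ∀ i → k ℕ.≤ i → coeff U i ≡ 0ℚ

-- U = Φ_m⁻¹ mod Φ_n : the (unique) U with deg U < φ(n) and Φ_m U ≡ 1 mod Φ_n
IsInvMod : ℕ → ℕ → Poly → Set
IsInvMod m n U = DegLt U (φ n) × InvCong (Φ m) (Φ n) U

{-# OPTIONS --safe #-}
-- Write Ones n = 1 + X + ⋯ + X^(n-1). Reducing the exponents 0, r, …, (p-1)r modulo p gives
-- Ones p (X^r) = Ones p + (X^p - 1) G, where G is the sum of X^i over the gaps i of the numerical
-- semigroup generated by p and r. As Φ_pr Φ_p = Φ_p (X^r), this says Φ_pr = 1 + (X - 1) G, which is (ii).
-- For (iii), Φ_pr Φ_r = Φ_r (X^p) = r + (X^p - 1) T with an explicit T, and Φ_r may be replaced by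
-- Ones d modulo Φ_p whenever d ≡ r modulo p. Taking d = r mod p gives Φ_p Z + Φ_pr (Ones d) = r with
-- Z of degree less than φ(pr). The coefficient of X^i in Z is at most that of T plus the number of
-- i - d - j p (0 ≤ j < ⌊r/p⌋) that are not gaps; if i = k p with k + ⌊r/p⌋ < r, all of them are gaps.
-- For (iv), let m p ≡ 1 modulo r with m < r: then Φ_p inverts 1 + X^p + ⋯ + X^((m-1)p) modulo Φ_r.
-- Reducing the exponents modulo r leaves distinct powers, and a multiple of Φ_r clears X^(r-1).
module Submission where

open import Defs
open import Data.Nat as ℕ using (ℕ; zero; suc; _*_; _∸_; z≤n; s≤s; NonZero)
import Data.Nat.Properties as ℕₚ
import Data.Nat.DivMod as ℕ
open import Data.Nat.Divisibility using (_∣_; _∣?_; divides; divides-refl; ∣⇒≤; ∣-trans; *-cancelˡ-∣; m∣m*n; n∣m*n; 1∣_; m%n≡0⇒n∣m)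
open import Data.Nat.Coprimality as Coprimality using (Coprime; coprime?; coprime-divisor; coprime-Bézout)
open import Data.Nat.GCD using (module Bézout)
open import Data.Nat.Primality using (Prime; prime⇒nonZero; prime⇒nonTrivial; prime⇒irreducible)
open import Data.Nat.Tactic.RingSolver using () renaming (solve-∀ to ℕ-solve-∀)
open import Data.Integer as ℤ using (ℤ; +_)
open import Data.Integer.Divisibility as ℤᵈ using ()
import Data.Integer.Properties as ℤₚ
open import Data.Rational as ℚ using (ℚ; 0ℚ; 1ℚ; _/_)
import Data.Rational.Properties as ℚₚ
open import Data.Rational.Unnormalised as ℚᵘ using (mkℚᵘ; *≡*)
import Data.Rational.Unnormalised.Properties as ℚᵘₚ
open import Data.List using (List; []; _∷_; _++_; [_]; map; filter; length; reverse; foldl; replicate; dropWhile; upTo; applyUpTo; applyDownFrom)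
import Data.List.Properties as Listₚ
open import Data.List.Membership.Propositional using (_∈_)
open import Data.List.Membership.Propositional.Properties using (∈-∃++; ∈-++⁺ˡ; ∈-++⁺ʳ; ∈-++⁻; ∈-map⁺; ∈-map⁻; ∈-upTo⁺; ∈-upTo⁻; ∈-filter⁺)
open import Data.List.Relation.Unary.Any using (here; there)
open import Data.List.Relation.Unary.All as All using ()
open import Data.List.Relation.Unary.AllPairs using (_∷_)
open import Data.List.Relation.Unary.Unique.Propositional using (Unique)
import Data.List.Relation.Unary.Unique.Propositional.Properties as Uniqueₚ
open import Data.Maybe using (Maybe; just; nothing)
open import Data.Product using (_×_; _,_; proj₁; proj₂; ∃)
open import Data.Sum using (_⊎_; inj₁; inj₂; [_,_]′)
open import Function using (_∘_)
open import Level using (0ℓ)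
open import Relation.Nullary using (Dec; yes; no; ¬_; contradiction)
open import Relation.Binary.Bundles using (Setoid)
open import Relation.Binary.Definitions using (tri<; tri≈; tri>)
open import Relation.Binary.PropositionalEquality hiding ([_])
import Relation.Binary.Reasoning.Setoid as SetoidReasoning
open import Algebra.Bundles using (CommutativeRing)
open import Tactic.RingSolver using (solve-∀)
open import Tactic.RingSolver.Core.AlmostCommutativeRing using (AlmostCommutativeRing; fromCommutativeRing)

-- `Φ` is defined by long division and `φ` by counting, so neither computes when the prime is a
-- variable. The way around the first is that a factorisation determines the quotient: once `D *ₚ Q`
-- is X^n - 1 with `D` monic, dividing by `D` returns `Q`, and the semigroup of p and r supplies the
-- factor `Ψ`. The totient enters only as a degree bound, so it is estimated from below by counting.
-- Cancellation is always by X^a - 1, where it follows from the finiteness of lists. In (iii) the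
-- defining formula of `Z` has terms whose degree can reach φ(pr) or more; they cancel because the
-- length r mod p is less than p. The bound on the coefficients of `Z` leaves no slack: T alone
-- already has constant coefficient r - 1. The crude estimate ⌊r/p⌋ for the other term is therefore
-- too weak near X^0, which is where the gaps are needed.

≡0? : ∀ a → Maybe (0ℚ ≡ a)
≡0? a with 0ℚ ℚₚ.≟ a
... | yes e = just e
... | no _ = nothing

ℚ-ring : AlmostCommutativeRing 0ℓ 0ℓ
ℚ-ring = fromCommutativeRing ℚₚ.+-*-commutativeRing ≡0?

-- The commutative ring of coefficient lists, up to trailing zeros

coeff-+ : ∀ A B i → coeff (A +ₚ B) i ≡ coeff A i ℚ.+ coeff B i
coeff-+ [] B i = sym (ℚₚ.+-identityˡ _)
coeff-+ (a ∷ A) [] i = sym (ℚₚ.+-identityʳ _)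
coeff-+ (a ∷ A) (b ∷ B) zero = refl
coeff-+ (a ∷ A) (b ∷ B) (suc i) = coeff-+ A B i

coeff-scale : ∀ c A i → coeff (scaleₚ c A) i ≡ c ℚ.* coeff A i
coeff-scale c [] i = sym (ℚₚ.*-zeroʳ c)
coeff-scale c (a ∷ A) zero = refl
coeff-scale c (a ∷ A) (suc i) = coeff-scale c A i

coeff-neg : ∀ A i → coeff (-ₚ A) i ≡ ℚ.- coeff A i
coeff-neg [] i = refl
coeff-neg (a ∷ A) zero = refl
coeff-neg (a ∷ A) (suc i) = coeff-neg A i

-- _≈ₚ_ as a record, so that the two polynomials can be inferred from a proof of equality.
infix 4 _≋_
record _≋_ (A B : Poly) : Set where
  constructor by-coeff
  field at : A ≈ₚ B
open _≋_ public

≋-refl : ∀ {A} → A ≋ A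
≋-refl = by-coeff λ _ → refl

≋-sym : ∀ {A B} → A ≋ B → B ≋ A
≋-sym e = by-coeff λ i → sym (at e i)

≋-trans : ∀ {A B C} → A ≋ B → B ≋ C → A ≋ C
≋-trans e f = by-coeff λ i → trans (at e i) (at f i)

≋-setoid : Setoid 0ℓ 0ℓ
≋-setoid = record { Carrier = Poly ; _≈_ = _≋_
  ; isEquivalence = record { refl = ≋-refl ; sym = ≋-sym ; trans = ≋-trans } }

module ≋-Reasoning = SetoidReasoning ≋-setoid

+ₚ-cong : ∀ {A B C D} → A ≋ B → C ≋ D → A +ₚ C ≋ B +ₚ D
+ₚ-cong {A} {B} {C} {D} e f = by-coeff λ i →
  trans (coeff-+ A C i) (trans (cong₂ ℚ._+_ (at e i) (at f i)) (sym (coeff-+ B D i)))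

-ₚ-cong : ∀ {A B} → A ≋ B → -ₚ A ≋ -ₚ B
-ₚ-cong {A} {B} e = by-coeff λ i →
  trans (coeff-neg A i) (trans (cong ℚ.-_ (at e i)) (sym (coeff-neg B i)))

scale-cong : ∀ c {A B} → A ≋ B → scaleₚ c A ≋ scaleₚ c B
scale-cong c {A} {B} e = by-coeff λ i →
  trans (coeff-scale c A i) (trans (cong (c ℚ.*_) (at e i)) (sym (coeff-scale c B i)))

∷-cong : ∀ a {A B} → A ≋ B → a ∷ A ≋ a ∷ B
∷-cong a e = by-coeff λ { zero → refl ; (suc i) → at e i }

+ₚ-assoc : ∀ A B C → (A +ₚ B) +ₚ C ≋ A +ₚ (B +ₚ C)
+ₚ-assoc A B C = by-coeff go
  where
  go : (A +ₚ B) +ₚ C ≈ₚ A +ₚ (B +ₚ C)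
  go i rewrite coeff-+ (A +ₚ B) C i | coeff-+ A B i | coeff-+ A (B +ₚ C) i | coeff-+ B C i = ℚₚ.+-assoc (coeff A i) (coeff B i) (coeff C i)

+ₚ-comm : ∀ A B → A +ₚ B ≋ B +ₚ A
+ₚ-comm A B = by-coeff λ i →
  trans (coeff-+ A B i) (trans (ℚₚ.+-comm (coeff A i) (coeff B i)) (sym (coeff-+ B A i)))

+ₚ-identityʳ : ∀ A → A +ₚ [] ≋ A
+ₚ-identityʳ A = by-coeff λ i → trans (coeff-+ A [] i) (ℚₚ.+-identityʳ _)

-ₚ-inverseʳ : ∀ A → A +ₚ (-ₚ A) ≋ []
-ₚ-inverseʳ A = by-coeff λ i → trans (coeff-+ A (-ₚ A) i)
  (trans (cong (coeff A i ℚ.+_) (coeff-neg A i)) (ℚₚ.+-inverseʳ (coeff A i)))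

coeff-*-zero : ∀ a A B → coeff ((a ∷ A) *ₚ B) 0 ≡ a ℚ.* coeff B 0
coeff-*-zero a A B = trans (coeff-+ (scaleₚ a B) (0ℚ ∷ (A *ₚ B)) 0)
  (trans (ℚₚ.+-identityʳ _) (coeff-scale a B 0))

coeff-*-suc : ∀ a A B i → coeff ((a ∷ A) *ₚ B) (suc i) ≡ a ℚ.* coeff B (suc i) ℚ.+ coeff (A *ₚ B) i
coeff-*-suc a A B i = trans (coeff-+ (scaleₚ a B) (0ℚ ∷ (A *ₚ B)) (suc i))
  (cong (ℚ._+ _) (coeff-scale a B (suc i)))

*ₚ-congʳ : ∀ A {B C} → B ≋ C → A *ₚ B ≋ A *ₚ C
*ₚ-congʳ [] e = ≋-refl
*ₚ-congʳ (a ∷ A) e = +ₚ-cong (scale-cong a e) (∷-cong 0ℚ (*ₚ-congʳ A e))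

*ₚ-distribˡ : ∀ A B C → A *ₚ (B +ₚ C) ≋ A *ₚ B +ₚ A *ₚ C
*ₚ-distribˡ A B C = by-coeff (go A)
  where
  interchange : ∀ a b c d e → a ℚ.* (b ℚ.+ c) ℚ.+ (d ℚ.+ e) ≡ a ℚ.* b ℚ.+ d ℚ.+ (a ℚ.* c ℚ.+ e)
  interchange = solve-∀ ℚ-ring
  go : ∀ A → A *ₚ (B +ₚ C) ≈ₚ A *ₚ B +ₚ A *ₚ C
  go [] i = refl
  go (a ∷ A) zero
    rewrite coeff-+ ((a ∷ A) *ₚ B) ((a ∷ A) *ₚ C) 0
          | coeff-*-zero a A (B +ₚ C) | coeff-*-zero a A B | coeff-*-zero a A C | coeff-+ B C 0 = ℚₚ.*-distribˡ-+ a (coeff B 0) (coeff C 0)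
  go (a ∷ A) (suc i)
    rewrite coeff-+ ((a ∷ A) *ₚ B) ((a ∷ A) *ₚ C) (suc i)
          | coeff-*-suc a A (B +ₚ C) i | coeff-*-suc a A B i | coeff-*-suc a A C i | coeff-+ B C (suc i)
          | go A i | coeff-+ (A *ₚ B) (A *ₚ C) i = interchange a (coeff B (suc i)) (coeff C (suc i)) (coeff (A *ₚ B) i) (coeff (A *ₚ C) i)

*ₚ-scaleʳ : ∀ c A B → A *ₚ scaleₚ c B ≋ scaleₚ c (A *ₚ B)
*ₚ-scaleʳ c A B = by-coeff (go A)
  where
  extract₀ : ∀ a c b → a ℚ.* (c ℚ.* b) ≡ c ℚ.* (a ℚ.* b)
  extract₀ = solve-∀ ℚ-ring
  extract : ∀ c a b d → a ℚ.* (c ℚ.* b) ℚ.+ c ℚ.* d ≡ c ℚ.* (a ℚ.* b ℚ.+ d)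
  extract = solve-∀ ℚ-ring
  go : ∀ A → A *ₚ scaleₚ c B ≈ₚ scaleₚ c (A *ₚ B)
  go [] i = refl
  go (a ∷ A) zero
    rewrite coeff-scale c ((a ∷ A) *ₚ B) 0 | coeff-*-zero a A (scaleₚ c B) | coeff-*-zero a A B
          | coeff-scale c B 0 = extract₀ a c (coeff B 0)
  go (a ∷ A) (suc i)
    rewrite coeff-scale c ((a ∷ A) *ₚ B) (suc i) | coeff-*-suc a A (scaleₚ c B) i | coeff-*-suc a A B i
          | coeff-scale c B (suc i) | go A i | coeff-scale c (A *ₚ B) i = extract c a (coeff B (suc i)) (coeff (A *ₚ B) i)

*ₚ-shiftʳ : ∀ A B → A *ₚ (0ℚ ∷ B) ≋ 0ℚ ∷ (A *ₚ B)
*ₚ-shiftʳ A B = by-coeff (go A)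
  where
  go : ∀ A → A *ₚ (0ℚ ∷ B) ≈ₚ 0ℚ ∷ (A *ₚ B)
  go [] zero = refl
  go [] (suc i) = refl
  go (a ∷ A) zero = trans (coeff-*-zero a A (0ℚ ∷ B)) (ℚₚ.*-zeroʳ a)
  go (a ∷ A) (suc zero)
    rewrite coeff-*-suc a A (0ℚ ∷ B) 0 | go A 0 | coeff-*-zero a A B = ℚₚ.+-identityʳ (a ℚ.* coeff B 0)
  go (a ∷ A) (suc (suc i))
    rewrite coeff-*-suc a A (0ℚ ∷ B) (suc i) | go A (suc i) | coeff-*-suc a A B i = refl

*ₚ-zeroʳ : ∀ A → A *ₚ [] ≋ []
*ₚ-zeroʳ [] = ≋-refl
*ₚ-zeroʳ (a ∷ A) = by-coeff λ { zero → refl ; (suc i) → at (*ₚ-zeroʳ A) i }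

*ₚ-constʳ : ∀ A b → A *ₚ constₚ b ≋ scaleₚ b A
*ₚ-constʳ A b = by-coeff (go A)
  where
  go : ∀ A → A *ₚ constₚ b ≈ₚ scaleₚ b A
  go [] i = refl
  go (a ∷ A) zero = trans (coeff-*-zero a A (constₚ b)) (ℚₚ.*-comm a b)
  go (a ∷ A) (suc i) rewrite coeff-*-suc a A (constₚ b) i | go A i | ℚₚ.*-zeroʳ a = ℚₚ.+-identityˡ (coeff (scaleₚ b A) i)

∷-split : ∀ a A → a ∷ A ≋ constₚ a +ₚ (0ℚ ∷ A)
∷-split a A = by-coeff λ { zero → sym (ℚₚ.+-identityʳ a) ; (suc i) → refl }

-- The product recurses on its left factor only. Writing `a ∷ A` as a + X A and using the rules for
-- a constant and for a shift on the right recovers the same recursion on the other side.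
*ₚ-comm : ∀ A B → A *ₚ B ≋ B *ₚ A
*ₚ-comm [] B = ≋-sym (*ₚ-zeroʳ B)
*ₚ-comm (a ∷ A) B = begin
  scaleₚ a B +ₚ (0ℚ ∷ A *ₚ B)            ≈⟨ +ₚ-cong (≋-sym (*ₚ-constʳ B a)) (∷-cong 0ℚ (*ₚ-comm A B)) ⟩
  B *ₚ constₚ a +ₚ (0ℚ ∷ B *ₚ A)         ≈⟨ +ₚ-cong ≋-refl (*ₚ-shiftʳ B A) ⟨
  B *ₚ constₚ a +ₚ B *ₚ (0ℚ ∷ A)         ≈⟨ *ₚ-distribˡ B (constₚ a) (0ℚ ∷ A) ⟨
  B *ₚ (constₚ a +ₚ (0ℚ ∷ A))            ≈⟨ *ₚ-congʳ B (∷-split a A) ⟨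
  B *ₚ (a ∷ A)                           ∎
  where open ≋-Reasoning

*ₚ-cong : ∀ {A B C D} → A ≋ B → C ≋ D → A *ₚ C ≋ B *ₚ D
*ₚ-cong {A} {B} {C} {D} e f = begin
  A *ₚ C ≈⟨ *ₚ-congʳ A f ⟩
  A *ₚ D ≈⟨ *ₚ-comm A D ⟩
  D *ₚ A ≈⟨ *ₚ-congʳ D e ⟩
  D *ₚ B ≈⟨ *ₚ-comm D B ⟩
  B *ₚ D ∎
  where open ≋-Reasoning

*ₚ-distribʳ : ∀ C A B → (A +ₚ B) *ₚ C ≋ A *ₚ C +ₚ B *ₚ C
*ₚ-distribʳ C A B = ≋-trans (*ₚ-comm (A +ₚ B) C)
  (≋-trans (*ₚ-distribˡ C A B) (+ₚ-cong (*ₚ-comm C A) (*ₚ-comm C B)))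

*ₚ-scaleˡ : ∀ c A B → scaleₚ c A *ₚ B ≋ scaleₚ c (A *ₚ B)
*ₚ-scaleˡ c A B = ≋-trans (*ₚ-comm (scaleₚ c A) B)
  (≋-trans (*ₚ-scaleʳ c B A) (scale-cong c (*ₚ-comm B A)))

*ₚ-shiftˡ : ∀ A B → (0ℚ ∷ A) *ₚ B ≋ 0ℚ ∷ (A *ₚ B)
*ₚ-shiftˡ A B = ≋-trans (*ₚ-comm (0ℚ ∷ A) B)
  (≋-trans (*ₚ-shiftʳ B A) (∷-cong 0ℚ (*ₚ-comm B A)))

*ₚ-assoc : ∀ A B C → (A *ₚ B) *ₚ C ≋ A *ₚ (B *ₚ C)
*ₚ-assoc [] B C = ≋-refl
*ₚ-assoc (a ∷ A) B C = ≋-trans (*ₚ-distribʳ C (scaleₚ a B) (0ℚ ∷ A *ₚ B))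
  (+ₚ-cong (*ₚ-scaleˡ a B C) (≋-trans (*ₚ-shiftˡ (A *ₚ B) C) (∷-cong 0ℚ (*ₚ-assoc A B C))))

*ₚ-identityʳ : ∀ A → A *ₚ 1ₚ ≋ A
*ₚ-identityʳ A = by-coeff λ i →
  trans (at (*ₚ-constʳ A 1ℚ) i) (trans (coeff-scale 1ℚ A i) (ℚₚ.*-identityˡ _))

*ₚ-identityˡ : ∀ A → 1ₚ *ₚ A ≋ A
*ₚ-identityˡ A = ≋-trans (*ₚ-comm 1ₚ A) (*ₚ-identityʳ A)

polyRing : CommutativeRing 0ℓ 0ℓ
polyRing = record
  { Carrier = Poly ; _≈_ = _≋_ ; _+_ = _+ₚ_ ; _*_ = _*ₚ_ ; -_ = -ₚ_ ; 0# = [] ; 1# = 1ₚ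
  ; isCommutativeRing = record
    { isRing = record
      { +-isAbelianGroup = record
        { isGroup = record
          { isMonoid = record
            { isSemigroup = record
              { isMagma = record
                { isEquivalence = Setoid.isEquivalence ≋-setoid
                ; ∙-cong = +ₚ-cong }
              ; assoc = +ₚ-assoc }
            ; identity = (λ A → ≋-refl) , +ₚ-identityʳ }
          ; inverse = (λ A → ≋-trans (+ₚ-comm (-ₚ A) A) (-ₚ-inverseʳ A)) , -ₚ-inverseʳ
          ; ⁻¹-cong = -ₚ-cong }
        ; comm = +ₚ-comm }
      ; *-cong = *ₚ-cong
      ; *-assoc = *ₚ-assoc
      ; *-identity = *ₚ-identityˡ , *ₚ-identityʳ
      ; distrib = *ₚ-distribˡ , *ₚ-distribʳ }
    ; *-comm = *ₚ-comm } }

-- The zero test by which the ring solver drops coefficients that cancel; it sees through trailing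
-- zeros.
≋[]? : ∀ A → Maybe ([] ≋ A)
≋[]? [] = just ≋-refl
≋[]? (a ∷ A) with 0ℚ ℚₚ.≟ a | ≋[]? A
... | yes e | just f = just (by-coeff λ { zero → e ; (suc i) → at f i })
... | _ | _ = nothing

poly-ring : AlmostCommutativeRing 0ℓ 0ℓ
poly-ring = fromCommutativeRing polyRing ≋[]?

-- Coefficients of shifts and degrees of products

X^*-coeff : ∀ n A i → coeff (X^ n *ₚ A) (n ℕ.+ i) ≡ coeff A i
X^*-coeff zero A i = at (*ₚ-identityˡ A) i
X^*-coeff (suc n) A i = trans (at (*ₚ-shiftˡ (X^ n) A) (suc n ℕ.+ i)) (X^*-coeff n A i)

X^*-coeff-≥ : ∀ n A i → n ℕ.≤ i → coeff (X^ n *ₚ A) i ≡ coeff A (i ∸ n)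
X^*-coeff-≥ n A i n≤i =
  trans (cong (coeff (X^ n *ₚ A)) (sym (ℕₚ.m+[n∸m]≡n n≤i))) (X^*-coeff n A (i ∸ n))

X^*-coeff-< : ∀ n A i → i ℕ.< n → coeff (X^ n *ₚ A) i ≡ 0ℚ
X^*-coeff-< (suc n) A zero _ = at (*ₚ-shiftˡ (X^ n) A) 0
X^*-coeff-< (suc n) A (suc i) (s≤s i<n) =
  trans (at (*ₚ-shiftˡ (X^ n) A) (suc i)) (X^*-coeff-< n A i i<n)

X^-+ : ∀ m n → X^ m *ₚ X^ n ≋ X^ (m ℕ.+ n)
X^-+ zero n = *ₚ-identityˡ (X^ n)
X^-+ (suc m) n = ≋-trans (*ₚ-shiftˡ (X^ m) (X^ n)) (∷-cong 0ℚ (X^-+ m n))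

coeff-X^ : ∀ n → coeff (X^ n) n ≡ 1ℚ
coeff-X^ zero = refl
coeff-X^ (suc n) = coeff-X^ n

coeff-X^-≢ : ∀ {n i} → i ≢ n → coeff (X^ n) i ≡ 0ℚ
coeff-X^-≢ {zero} {zero} i≢n = contradiction refl i≢n
coeff-X^-≢ {zero} {suc i} i≢n = refl
coeff-X^-≢ {suc n} {zero} i≢n = refl
coeff-X^-≢ {suc n} {suc i} i≢n = coeff-X^-≢ {n} {i} (i≢n ∘ cong suc)

coeff-- : ∀ A B i → coeff (A -ₚ B) i ≡ coeff A i ℚ.- coeff B i
coeff-- A B i = trans (coeff-+ A (-ₚ B) i) (cong (coeff A i ℚ.+_) (coeff-neg B i))

DegLt-resp : ∀ {A B n} → A ≋ B → DegLt A n → DegLt B n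
DegLt-resp e d i n≤i = trans (sym (at e i)) (d i n≤i)

DegLt-+ : ∀ {A B n} → DegLt A n → DegLt B n → DegLt (A +ₚ B) n
DegLt-+ {A} {B} d e i n≤i rewrite coeff-+ A B i | d i n≤i | e i n≤i = refl

DegLt-neg : ∀ {A n} → DegLt A n → DegLt (-ₚ A) n
DegLt-neg {A} d i n≤i rewrite coeff-neg A i | d i n≤i = refl

DegLt-scale : ∀ c {A n} → DegLt A n → DegLt (scaleₚ c A) n
DegLt-scale c {A} d i n≤i rewrite coeff-scale c A i | d i n≤i = ℚₚ.*-zeroʳ c

DegLt-weaken : ∀ {A m n} → m ℕ.≤ n → DegLt A m → DegLt A n
DegLt-weaken m≤n d i n≤i = d i (ℕₚ.≤-trans m≤n n≤i)

DegLt-X^ : ∀ n → DegLt (X^ n) (suc n)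
DegLt-X^ n i n<i = coeff-X^-≢ (ℕₚ.>⇒≢ n<i)

-- Degree at most `n` times degree less than `m`: with one strict and one weak bound no predecessor
-- appears, and `m = 0` covers the zero polynomial.
DegLt-* : ∀ {A B} n {m} → DegLt A (suc n) → DegLt B m → DegLt (A *ₚ B) (n ℕ.+ m)
DegLt-* {[]} n dA dB i _ = refl
DegLt-* {a ∷ A} {B} zero {m} dA dB = DegLt-+ {scaleₚ a B} (DegLt-scale a {B} dB) shifted
  where
  -- The tail `A` may be a nonempty list of zeros, so it vanishes only up to `_≋_`.
  A*B≋[] : A *ₚ B ≋ []
  A*B≋[] = *ₚ-cong {A} {[]} {B} (by-coeff λ i → dA (suc i) (s≤s z≤n)) ≋-refl
  shifted : DegLt (0ℚ ∷ A *ₚ B) m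
  shifted zero _ = refl
  shifted (suc i) _ = at A*B≋[] i
DegLt-* {a ∷ A} {B} (suc n) {m} dA dB =
  DegLt-+ {scaleₚ a B} (DegLt-weaken {scaleₚ a B} (ℕₚ.m≤n+m m (suc n)) (DegLt-scale a {B} dB)) shifted
  where
  shifted : DegLt (0ℚ ∷ A *ₚ B) (suc n ℕ.+ m)
  shifted (suc i) (s≤s n+m≤i) = DegLt-* {A} {B} n (λ j n<j → dA (suc j) (s≤s n<j)) dB i n+m≤i

-- Division by a monic polynomial

bigEndian : Poly → List ℚ
bigEndian A = dropWhile (λ x → x ℚₚ.≟ 0ℚ) (reverse A)

applyUpTo-coeff : ∀ A → applyUpTo (coeff A) (length A) ≡ A
applyUpTo-coeff [] = refl
applyUpTo-coeff (a ∷ A) = cong (a ∷_) (applyUpTo-coeff A)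

coeff-applyUpTo : ∀ {A n} → DegLt A n → applyUpTo (coeff A) n ≋ A
coeff-applyUpTo {[]} {zero} d = ≋-refl
coeff-applyUpTo {a ∷ A} {zero} d = by-coeff λ i → sym (d i z≤n)
coeff-applyUpTo {[]} {suc n} d = by-coeff λ { zero → refl ; (suc i) → at (coeff-applyUpTo {[]} {n} λ _ _ → refl) i }
coeff-applyUpTo {a ∷ A} {suc n} d = ∷-cong a (coeff-applyUpTo {A} λ i n≤i → d (suc i) (s≤s n≤i))

≢0⇒<length : ∀ A n → coeff A n ≢ 0ℚ → n ℕ.< length A
≢0⇒<length [] n c≢0 = contradiction refl c≢0
≢0⇒<length (a ∷ A) zero c≢0 = s≤s z≤n
≢0⇒<length (a ∷ A) (suc n) c≢0 = s≤s (≢0⇒<length A n c≢0)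

dropWhile-applyDownFrom : ∀ (f : ℕ → ℚ) n k → f n ≢ 0ℚ → (∀ i → n ℕ.< i → f i ≡ 0ℚ) →
  dropWhile (λ x → x ℚₚ.≟ 0ℚ) (applyDownFrom f (k ℕ.+ suc n)) ≡ applyDownFrom f (suc n)
dropWhile-applyDownFrom f n zero fn≢0 f≡0 with f n ℚₚ.≟ 0ℚ
... | yes fn≡0 = contradiction fn≡0 fn≢0
... | no _ = refl
dropWhile-applyDownFrom f n (suc k) fn≢0 f≡0 with f (k ℕ.+ suc n) ℚₚ.≟ 0ℚ
... | yes _ = dropWhile-applyDownFrom f n k fn≢0 f≡0
... | no f≢0 = contradiction (f≡0 (k ℕ.+ suc n) (ℕₚ.m≤n+m (suc n) k)) f≢0

-- A list is the table of its own coefficients. After reversal its trailing zeros come first, and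
-- `dropWhile` stops exactly at exponent `n`.
bigEndian-coeff : ∀ A n → coeff A n ≢ 0ℚ → DegLt A (suc n) → bigEndian A ≡ applyDownFrom (coeff A) (suc n)
bigEndian-coeff A n c≢0 d = begin
  bigEndian A                                                               ≡⟨ cong bigEndian (applyUpTo-coeff A) ⟨
  bigEndian (applyUpTo (coeff A) (length A))                                ≡⟨ cong (dropWhile _) (Listₚ.reverse-applyUpTo (coeff A) (length A)) ⟩
  dropWhile _ (applyDownFrom (coeff A) (length A))                          ≡⟨ cong (dropWhile _ ∘ applyDownFrom (coeff A)) (ℕₚ.m∸n+n≡m (≢0⇒<length A n c≢0)) ⟨
  dropWhile _ (applyDownFrom (coeff A) (length A ∸ suc n ℕ.+ suc n))        ≡⟨ dropWhile-applyDownFrom (coeff A) n (length A ∸ suc n) c≢0 d ⟩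
  applyDownFrom (coeff A) (suc n)                                           ∎
  where open ≡-Reasoning

subPrefix : List ℚ → List ℚ → List ℚ
subPrefix r       []      = r
subPrefix []      (_ ∷ _) = []
subPrefix (x ∷ r) (y ∷ s) = (x ℚ.- y) ∷ subPrefix r s

divSteps : ℕ → List ℚ → List ℚ → List ℚ
divSteps zero    r       dt = []
divSteps (suc k) []      dt = []
divSteps (suc k) (c ∷ r) dt = c ∷ divSteps k (subPrefix r (scaleₚ c dt)) dt

subPrefix-unique : (h : ℚ → List ℚ → List ℚ → List ℚ) →
  (∀ c r → h c r [] ≡ r) → (∀ c y s → h c [] (y ∷ s) ≡ []) →
  (∀ c x r y s → h c (x ∷ r) (y ∷ s) ≡ (x ℚ.- c ℚ.* y) ∷ h c r s) →
  ∀ c r s → h c r s ≡ subPrefix r (scaleₚ c s)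
subPrefix-unique h e₁ e₂ e₃ c r [] = e₁ c r
subPrefix-unique h e₁ e₂ e₃ c [] (y ∷ s) = e₂ c y s
subPrefix-unique h e₁ e₂ e₃ c (x ∷ r) (y ∷ s) =
  trans (e₃ c x r y s) (cong (_ ∷_) (subPrefix-unique h e₁ e₂ e₃ c r s))

-- Stated for arbitrary `f` and `h` obeying the defining equations, since the private functions
-- cannot be named. Scaling is made part of `h` so that in the third equation `h` is applied to
-- variables alone, where unification can solve for it.
divSteps-unique : (f : ℕ → List ℚ → List ℚ → List ℚ) (h : ℚ → List ℚ → List ℚ → List ℚ) →
  (∀ r dt → f 0 r dt ≡ []) → (∀ k dt → f (suc k) [] dt ≡ []) →
  (∀ k c r dt → f (suc k) (c ∷ r) dt ≡ c ∷ f k (h c r dt) dt) →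
  (∀ c r → h c r [] ≡ r) → (∀ c y s → h c [] (y ∷ s) ≡ []) →
  (∀ c x r y s → h c (x ∷ r) (y ∷ s) ≡ (x ℚ.- c ℚ.* y) ∷ h c r s) →
  ∀ k r dt → f k r dt ≡ divSteps k r dt
divSteps-unique f h f₁ f₂ f₃ e₁ e₂ e₃ zero r dt = f₁ r dt
divSteps-unique f h f₁ f₂ f₃ e₁ e₂ e₃ (suc k) [] dt = f₂ k dt
divSteps-unique f h f₁ f₂ f₃ e₁ e₂ e₃ (suc k) (c ∷ r) dt = trans (f₃ k c r dt)
  (cong (c ∷_) (trans (divSteps-unique f h f₁ f₂ f₃ e₁ e₂ e₃ k (h c r dt) dt)
                      (cong (λ u → divSteps k u dt) (subPrefix-unique h e₁ e₂ e₃ c r dt))))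

-- divSteps and subPrefix of Defs are private: the two metavariables below are
-- solved by them once everything around them in the goal is abstracted.
mutual
  Defs-divSteps : ℕ → List ℚ → List ℚ → List ℚ
  Defs-divSteps = _

  Defs-subPrefix-scale : ℚ → List ℚ → List ℚ → List ℚ
  Defs-subPrefix-scale = _

  quotₚ-divSteps : ∀ P D c dt → bigEndian D ≡ c ∷ dt →
    quotₚ P D ≡ reverse (divSteps (suc (length (bigEndian P)) ∸ suc (length dt)) (bigEndian P) dt)
  quotₚ-divSteps P D c dt eq with bigEndian D in e
  quotₚ-divSteps P D c dt refl | .(c ∷ dt) rewrite e with bigEndian P
  ... | r with suc (length r) ∸ suc (length dt)
  ... | k with foldl {A = List ℚ} {B = ℚ} (λ y x → x ∷ y) []
  ... | reverse′ = cong reverse′ (divSteps-unique Defs-divSteps Defs-subPrefix-scale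
    (λ _ _ → refl) (λ _ _ → refl) (λ _ _ _ _ → refl)
    (λ _ _ → refl) (λ _ _ _ → refl) (λ _ _ _ _ _ → refl) k r dt)

-- In big-endian order the first `n` of `n + m` entries are the exponents from `m` upwards, so
-- subtracting a prefix amounts to subtracting `g` shifted by X^m.
subPrefix-applyDownFrom : ∀ (f g h : ℕ → ℚ) n m →
  (∀ i → i ℕ.< m → h i ≡ f i) → (∀ i → i ℕ.< n → h (i ℕ.+ m) ≡ f (i ℕ.+ m) ℚ.- g i) →
  subPrefix (applyDownFrom f (n ℕ.+ m)) (applyDownFrom g n) ≡ applyDownFrom h (n ℕ.+ m)
subPrefix-applyDownFrom f g h zero zero low high = refl
subPrefix-applyDownFrom f g h zero (suc m) low high = cong₂ _∷_ (sym (low m ℕₚ.≤-refl))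
  (subPrefix-applyDownFrom f g h zero m (λ i i<m → low i (ℕₚ.m<n⇒m<1+n i<m)) (λ i ()))
subPrefix-applyDownFrom f g h (suc n) m low high = cong₂ _∷_ (sym (high n ℕₚ.≤-refl))
  (subPrefix-applyDownFrom f g h n m low (λ i i<n → high i (ℕₚ.m<n⇒m<1+n i<n)))

-- Long division seen from the quotient: each step strips the leading term of `Q`, and the remainder
-- is then `D *ₚ dropTop m Q`.
dropTop : ℕ → Poly → Poly
dropTop m Q = Q -ₚ scaleₚ (coeff Q m) (X^ m)

dropTop-coeff : ∀ m Q i → i ≢ m → coeff (dropTop m Q) i ≡ coeff Q i
dropTop-coeff m Q i i≢m = begin
  coeff (dropTop m Q) i                                  ≡⟨ coeff-- Q (scaleₚ (coeff Q m) (X^ m)) i ⟩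
  coeff Q i ℚ.- coeff (scaleₚ (coeff Q m) (X^ m)) i      ≡⟨ cong (λ x → coeff Q i ℚ.- x) (coeff-scale (coeff Q m) (X^ m) i) ⟩
  coeff Q i ℚ.- coeff Q m ℚ.* coeff (X^ m) i             ≡⟨ cong (λ x → coeff Q i ℚ.- coeff Q m ℚ.* x) (coeff-X^-≢ i≢m) ⟩
  coeff Q i ℚ.- coeff Q m ℚ.* 0ℚ                         ≡⟨ cong (λ x → coeff Q i ℚ.- x) (ℚₚ.*-zeroʳ (coeff Q m)) ⟩
  coeff Q i ℚ.- 0ℚ                                       ≡⟨ ℚₚ.+-identityʳ (coeff Q i) ⟩
  coeff Q i                                              ∎
  where open ≡-Reasoning

dropTop-top : ∀ m Q → coeff (dropTop m Q) m ≡ 0ℚ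
dropTop-top m Q = begin
  coeff (dropTop m Q) m                                  ≡⟨ coeff-- Q (scaleₚ (coeff Q m) (X^ m)) m ⟩
  coeff Q m ℚ.- coeff (scaleₚ (coeff Q m) (X^ m)) m      ≡⟨ cong (λ x → coeff Q m ℚ.- x) (coeff-scale (coeff Q m) (X^ m) m) ⟩
  coeff Q m ℚ.- coeff Q m ℚ.* coeff (X^ m) m             ≡⟨ cong (λ x → coeff Q m ℚ.- coeff Q m ℚ.* x) (coeff-X^ m) ⟩
  coeff Q m ℚ.- coeff Q m ℚ.* 1ℚ                         ≡⟨ cong (λ x → coeff Q m ℚ.- x) (ℚₚ.*-identityʳ (coeff Q m)) ⟩
  coeff Q m ℚ.- coeff Q m                                ≡⟨ ℚₚ.+-inverseʳ (coeff Q m) ⟩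
  0ℚ                                                     ∎
  where open ≡-Reasoning

DegLt-dropTop : ∀ m Q → DegLt Q (suc m) → DegLt (dropTop m Q) m
DegLt-dropTop m Q dQ i m≤i with i ℕₚ.≟ m
... | yes refl = dropTop-top m Q
... | no i≢m = trans (dropTop-coeff m Q i i≢m) (dQ i (ℕₚ.≤∧≢⇒< m≤i (i≢m ∘ sym)))

*ₚ-dropTop : ∀ D m Q → D *ₚ dropTop m Q ≋ D *ₚ Q -ₚ scaleₚ (coeff Q m) (X^ m *ₚ D)
*ₚ-dropTop D m Q = begin
  D *ₚ (Q -ₚ scaleₚ (coeff Q m) (X^ m))            ≈⟨ *ₚ-congʳ D (+ₚ-cong {Q} ≋-refl (-ₚ-cong (*ₚ-constʳ (X^ m) (coeff Q m)))) ⟨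
  D *ₚ (Q -ₚ X^ m *ₚ constₚ (coeff Q m))           ≈⟨ rearrange D Q (X^ m) (constₚ (coeff Q m)) ⟩
  D *ₚ Q -ₚ X^ m *ₚ D *ₚ constₚ (coeff Q m)        ≈⟨ +ₚ-cong {D *ₚ Q} ≋-refl (-ₚ-cong (*ₚ-constʳ (X^ m *ₚ D) (coeff Q m))) ⟩
  D *ₚ Q -ₚ scaleₚ (coeff Q m) (X^ m *ₚ D)         ∎
  where
  open ≋-Reasoning
  rearrange : ∀ D Q X C → D *ₚ (Q -ₚ X *ₚ C) ≋ D *ₚ Q -ₚ X *ₚ D *ₚ C
  rearrange = solve-∀ poly-ring

*ₚ-dropTop-coeff : ∀ D m Q i →
  coeff (D *ₚ dropTop m Q) i ≡ coeff (D *ₚ Q) i ℚ.- coeff Q m ℚ.* coeff (X^ m *ₚ D) i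
*ₚ-dropTop-coeff D m Q i = begin
  coeff (D *ₚ dropTop m Q) i                                      ≡⟨ at (*ₚ-dropTop D m Q) i ⟩
  coeff (D *ₚ Q -ₚ scaleₚ (coeff Q m) (X^ m *ₚ D)) i              ≡⟨ coeff-- (D *ₚ Q) (scaleₚ (coeff Q m) (X^ m *ₚ D)) i ⟩
  coeff (D *ₚ Q) i ℚ.- coeff (scaleₚ (coeff Q m) (X^ m *ₚ D)) i   ≡⟨ cong (λ x → coeff (D *ₚ Q) i ℚ.- x) (coeff-scale (coeff Q m) (X^ m *ₚ D) i) ⟩
  coeff (D *ₚ Q) i ℚ.- coeff Q m ℚ.* coeff (X^ m *ₚ D) i          ∎
  where open ≡-Reasoning

*ₚ-dropTop-high : ∀ D m Q i →
  coeff (D *ₚ dropTop m Q) (i ℕ.+ m) ≡ coeff (D *ₚ Q) (i ℕ.+ m) ℚ.- coeff Q m ℚ.* coeff D i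
*ₚ-dropTop-high D m Q i = trans (*ₚ-dropTop-coeff D m Q (i ℕ.+ m))
  (cong (λ x → coeff (D *ₚ Q) (i ℕ.+ m) ℚ.- coeff Q m ℚ.* x)
    (trans (cong (coeff (X^ m *ₚ D)) (ℕₚ.+-comm i m)) (X^*-coeff m D i)))

*ₚ-dropTop-low : ∀ D m Q i → i ℕ.< m → coeff (D *ₚ dropTop m Q) i ≡ coeff (D *ₚ Q) i
*ₚ-dropTop-low D m Q i i<m = begin
  coeff (D *ₚ dropTop m Q) i                                ≡⟨ *ₚ-dropTop-coeff D m Q i ⟩
  coeff (D *ₚ Q) i ℚ.- coeff Q m ℚ.* coeff (X^ m *ₚ D) i    ≡⟨ cong (λ x → coeff (D *ₚ Q) i ℚ.- coeff Q m ℚ.* x) (X^*-coeff-< m D i i<m) ⟩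
  coeff (D *ₚ Q) i ℚ.- coeff Q m ℚ.* 0ℚ                     ≡⟨ cong (λ x → coeff (D *ₚ Q) i ℚ.- x) (ℚₚ.*-zeroʳ (coeff Q m)) ⟩
  coeff (D *ₚ Q) i ℚ.- 0ℚ                                   ≡⟨ ℚₚ.+-identityʳ (coeff (D *ₚ Q) i) ⟩
  coeff (D *ₚ Q) i                                          ∎
  where open ≡-Reasoning

p-q≡0⇒p≡q : ∀ p q → p ℚ.- q ≡ 0ℚ → p ≡ q
p-q≡0⇒p≡q p q e = trans (cancel p q) (trans (cong (ℚ._+ q) e) (ℚₚ.+-identityˡ q))
  where
  cancel : ∀ x y → x ≡ (x ℚ.- y) ℚ.+ y
  cancel = solve-∀ ℚ-ring

-- Without its top term, `Q` gives a product of degree below `n + m`; the whole coefficient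
-- therefore comes from the top term, and `D` is monic.
*ₚ-coeff-top : ∀ D n → coeff D n ≡ 1ℚ → DegLt D (suc n) → ∀ m Q → DegLt Q (suc m) →
  coeff (D *ₚ Q) (n ℕ.+ m) ≡ coeff Q m
*ₚ-coeff-top D n monic dD m Q dQ = p-q≡0⇒p≡q (coeff (D *ₚ Q) (n ℕ.+ m)) (coeff Q m) (begin
  coeff (D *ₚ Q) (n ℕ.+ m) ℚ.- coeff Q m                   ≡⟨ cong (λ x → coeff (D *ₚ Q) (n ℕ.+ m) ℚ.- x) (ℚₚ.*-identityʳ (coeff Q m)) ⟨
  coeff (D *ₚ Q) (n ℕ.+ m) ℚ.- coeff Q m ℚ.* 1ℚ            ≡⟨ cong (λ x → coeff (D *ₚ Q) (n ℕ.+ m) ℚ.- coeff Q m ℚ.* x) monic ⟨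
  coeff (D *ₚ Q) (n ℕ.+ m) ℚ.- coeff Q m ℚ.* coeff D n     ≡⟨ *ₚ-dropTop-high D m Q n ⟨
  coeff (D *ₚ dropTop m Q) (n ℕ.+ m)                       ≡⟨ DegLt-* {D} n dD (DegLt-dropTop m Q dQ) (n ℕ.+ m) ℕₚ.≤-refl ⟩
  0ℚ                                                       ∎)
  where open ≡-Reasoning

applyDownFrom-cong : ∀ {f g : ℕ → ℚ} k → (∀ i → i ℕ.< k → f i ≡ g i) → applyDownFrom f k ≡ applyDownFrom g k
applyDownFrom-cong zero e = refl
applyDownFrom-cong (suc k) e = cong₂ _∷_ (e k ℕₚ.≤-refl) (applyDownFrom-cong k λ i i<k → e i (ℕₚ.m<n⇒m<1+n i<k))

subPrefix-* : ∀ D n m Q →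
  subPrefix (applyDownFrom (coeff (D *ₚ Q)) (n ℕ.+ m)) (scaleₚ (coeff Q m) (applyDownFrom (coeff D) n))
    ≡ applyDownFrom (coeff (D *ₚ dropTop m Q)) (n ℕ.+ m)
subPrefix-* D n m Q = trans
  (cong (subPrefix (applyDownFrom (coeff (D *ₚ Q)) (n ℕ.+ m))) (Listₚ.map-applyDownFrom (coeff D) (coeff Q m ℚ.*_) n))
  (subPrefix-applyDownFrom (coeff (D *ₚ Q)) (λ i → coeff Q m ℚ.* coeff D i) (coeff (D *ₚ dropTop m Q)) n m
    (*ₚ-dropTop-low D m Q) (λ i _ → *ₚ-dropTop-high D m Q i))

-- Induction on the quotient: the head of the remainder is the leading coefficient of `Q`, and
-- subtracting that multiple of `D` leaves the same problem for `dropTop m Q`.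
divSteps-* : ∀ D n → coeff D n ≡ 1ℚ → DegLt D (suc n) → ∀ m Q → DegLt Q m →
  divSteps m (applyDownFrom (coeff (D *ₚ Q)) (n ℕ.+ m)) (applyDownFrom (coeff D) n) ≡ applyDownFrom (coeff Q) m
divSteps-* D n monic dD zero Q dQ = refl
divSteps-* D n monic dD (suc m) Q dQ = begin
  divSteps (suc m) (applyDownFrom (coeff (D *ₚ Q)) (n ℕ.+ suc m)) dt
    ≡⟨ cong (λ k → divSteps (suc m) (applyDownFrom (coeff (D *ₚ Q)) k) dt) (ℕₚ.+-suc n m) ⟩
  step (coeff (D *ₚ Q) (n ℕ.+ m))
    ≡⟨ cong step (*ₚ-coeff-top D n monic dD m Q dQ) ⟩
  step (coeff Q m)
    ≡⟨ cong (λ r → coeff Q m ∷ divSteps m r dt) (subPrefix-* D n m Q) ⟩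
  coeff Q m ∷ divSteps m (applyDownFrom (coeff (D *ₚ dropTop m Q)) (n ℕ.+ m)) dt
    ≡⟨ cong (coeff Q m ∷_) (divSteps-* D n monic dD m (dropTop m Q) (DegLt-dropTop m Q dQ)) ⟩
  coeff Q m ∷ applyDownFrom (coeff (dropTop m Q)) m
    ≡⟨ cong (coeff Q m ∷_) (applyDownFrom-cong m (λ i i<m → dropTop-coeff m Q i (ℕₚ.<⇒≢ i<m))) ⟩
  applyDownFrom (coeff Q) (suc m) ∎
  where
  open ≡-Reasoning
  dt = applyDownFrom (coeff D) n
  step : ℚ → List ℚ
  step c = c ∷ divSteps m (subPrefix (applyDownFrom (coeff (D *ₚ Q)) (n ℕ.+ m)) (scaleₚ c dt)) dt

1≢0 : 1ℚ ≢ 0ℚ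
1≢0 ()

-- The only access to `quotₚ`: a factorisation found by other means determines the quotient. The
-- nonzero coefficient of `P` fixes the length of its big-endian form, hence the number of division
-- steps.
quotₚ-* : ∀ P D Q n m → coeff D n ≡ 1ℚ → DegLt D (suc n) → coeff P (n ℕ.+ m) ≢ 0ℚ → DegLt Q (suc m) →
  D *ₚ Q ≋ P → quotₚ P D ≋ Q
quotₚ-* P D Q n m monic dD lead dQ D*Q≋P = subst (_≋ Q) (sym quot≡) (coeff-applyUpTo dQ)
  where
  open ≡-Reasoning
  dt = applyDownFrom (coeff D) n
  dP : DegLt P (suc (n ℕ.+ m))
  dP = subst (DegLt P) (ℕₚ.+-suc n m) (DegLt-resp D*Q≋P (DegLt-* {D} {Q} n dD dQ))
  bigEndian-P : bigEndian P ≡ applyDownFrom (coeff (D *ₚ Q)) (n ℕ.+ suc m)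
  bigEndian-P = begin
    bigEndian P                                   ≡⟨ bigEndian-coeff P (n ℕ.+ m) lead dP ⟩
    applyDownFrom (coeff P) (suc (n ℕ.+ m))        ≡⟨ cong (applyDownFrom (coeff P)) (ℕₚ.+-suc n m) ⟨
    applyDownFrom (coeff P) (n ℕ.+ suc m)          ≡⟨ ext (n ℕ.+ suc m) ⟩
    applyDownFrom (coeff (D *ₚ Q)) (n ℕ.+ suc m)   ∎
    where
    ext : ∀ k → applyDownFrom (coeff P) k ≡ applyDownFrom (coeff (D *ₚ Q)) k
    ext zero = refl
    ext (suc k) = cong₂ _∷_ (sym (at D*Q≋P k)) (ext k)
  steps≡ : suc (length (applyDownFrom (coeff (D *ₚ Q)) (n ℕ.+ suc m))) ∸ suc (length dt) ≡ suc m
  steps≡ rewrite Listₚ.length-applyDownFrom (coeff (D *ₚ Q)) (n ℕ.+ suc m) | Listₚ.length-applyDownFrom (coeff D) n = ℕₚ.m+n∸m≡n n (suc m)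
  quot≡ : quotₚ P D ≡ applyUpTo (coeff Q) (suc m)
  quot≡ = begin
    quotₚ P D
      ≡⟨ quotₚ-divSteps P D (coeff D n) dt (bigEndian-coeff D n (λ e → 1≢0 (trans (sym monic) e)) dD) ⟩
    reverse (divSteps (suc (length (bigEndian P)) ∸ suc (length dt)) (bigEndian P) dt)
      ≡⟨ cong (λ r → reverse (divSteps (suc (length r) ∸ suc (length dt)) r dt)) bigEndian-P ⟩
    reverse (divSteps (suc (length (applyDownFrom (coeff (D *ₚ Q)) (n ℕ.+ suc m))) ∸ suc (length dt)) (applyDownFrom (coeff (D *ₚ Q)) (n ℕ.+ suc m)) dt)
      ≡⟨ cong (λ k → reverse (divSteps k (applyDownFrom (coeff (D *ₚ Q)) (n ℕ.+ suc m)) dt)) steps≡ ⟩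
    reverse (divSteps (suc m) (applyDownFrom (coeff (D *ₚ Q)) (n ℕ.+ suc m)) dt)
      ≡⟨ cong reverse (divSteps-* D n monic dD (suc m) Q dQ) ⟩
    reverse (applyDownFrom (coeff Q) (suc m))
      ≡⟨ Listₚ.reverse-applyDownFrom (coeff Q) (suc m) ⟩
    applyUpTo (coeff Q) (suc m) ∎

-- Sums of powers

X : Poly
X = X^ 1

∷-X : ∀ a A → a ∷ A ≋ constₚ a +ₚ X *ₚ A
∷-X a A = begin
  a ∷ A                         ≈⟨ ∷-split a A ⟩
  constₚ a +ₚ (0ℚ ∷ A)          ≈⟨ +ₚ-cong {constₚ a} ≋-refl (∷-cong 0ℚ (*ₚ-identityˡ A)) ⟨
  constₚ a +ₚ (0ℚ ∷ 1ₚ *ₚ A)    ≈⟨ +ₚ-cong {constₚ a} ≋-refl (*ₚ-shiftˡ 1ₚ A) ⟨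
  constₚ a +ₚ X *ₚ A            ∎
  where open ≋-Reasoning

ones : ℕ → Poly
ones n = replicate n 1ℚ

ones-telescope : ∀ n → (X -ₚ 1ₚ) *ₚ ones n ≋ X^ n -ₚ 1ₚ
ones-telescope zero = ≋-trans (*ₚ-zeroʳ (X -ₚ 1ₚ)) (≋-sym (-ₚ-inverseʳ 1ₚ))
ones-telescope (suc n) = begin
  (X -ₚ 1ₚ) *ₚ ones (suc n)                   ≈⟨ *ₚ-congʳ (X -ₚ 1ₚ) (∷-X 1ℚ (ones n)) ⟩
  (X -ₚ 1ₚ) *ₚ (1ₚ +ₚ X *ₚ ones n)            ≈⟨ rearrange X (ones n) ⟩
  X -ₚ 1ₚ +ₚ X *ₚ ((X -ₚ 1ₚ) *ₚ ones n)       ≈⟨ +ₚ-cong {X -ₚ 1ₚ} ≋-refl (*ₚ-congʳ X (ones-telescope n)) ⟩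
  X -ₚ 1ₚ +ₚ X *ₚ (X^ n -ₚ 1ₚ)                ≈⟨ rearrange′ X (X^ n) ⟩
  X *ₚ X^ n -ₚ 1ₚ                             ≈⟨ +ₚ-cong (X^-+ 1 n) ≋-refl ⟩
  X^ (suc n) -ₚ 1ₚ                            ∎
  where
  open ≋-Reasoning
  rearrange : ∀ X Y → (X -ₚ 1ₚ) *ₚ (1ₚ +ₚ X *ₚ Y) ≋ X -ₚ 1ₚ +ₚ X *ₚ ((X -ₚ 1ₚ) *ₚ Y)
  rearrange = solve-∀ poly-ring
  rearrange′ : ∀ X Y → X -ₚ 1ₚ +ₚ X *ₚ (Y -ₚ 1ₚ) ≋ X *ₚ Y -ₚ 1ₚ
  rearrange′ = solve-∀ poly-ring

sumₚ : (ℕ → Poly) → ℕ → Poly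
sumₚ f zero = []
sumₚ f (suc n) = sumₚ f n +ₚ f n

-- The quotient (X^(an) - 1) / (X^a - 1); for `n` prime it is Φ_n (X^a).
geo : ℕ → ℕ → Poly
geo a = sumₚ (λ j → X^ (a ℕ.* j))

geo-telescope : ∀ a n → (X^ a -ₚ 1ₚ) *ₚ geo a n ≋ X^ (a ℕ.* n) -ₚ 1ₚ
geo-telescope a zero rewrite ℕₚ.*-zeroʳ a = ≋-trans (*ₚ-zeroʳ (X^ a -ₚ 1ₚ)) (≋-sym (-ₚ-inverseʳ 1ₚ))
geo-telescope a (suc n) = begin
  (X^ a -ₚ 1ₚ) *ₚ (geo a n +ₚ Y)                  ≈⟨ rearrange (X^ a) (geo a n) Y ⟩
  (X^ a -ₚ 1ₚ) *ₚ geo a n +ₚ (X^ a *ₚ Y -ₚ Y)     ≈⟨ +ₚ-cong (geo-telescope a n) ≋-refl ⟩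
  Y -ₚ 1ₚ +ₚ (X^ a *ₚ Y -ₚ Y)                     ≈⟨ rearrange′ Y (X^ a *ₚ Y) ⟩
  X^ a *ₚ Y -ₚ 1ₚ                                 ≈⟨ +ₚ-cong (X^-+ a (a ℕ.* n)) ≋-refl ⟩
  X^ (a ℕ.+ a ℕ.* n) -ₚ 1ₚ                        ≡⟨ cong (λ k → X^ k -ₚ 1ₚ) (ℕₚ.*-suc a n) ⟨
  X^ (a ℕ.* suc n) -ₚ 1ₚ                          ∎
  where
  open ≋-Reasoning
  Y = X^ (a ℕ.* n)
  rearrange : ∀ X G Y → (X -ₚ 1ₚ) *ₚ (G +ₚ Y) ≋ (X -ₚ 1ₚ) *ₚ G +ₚ (X *ₚ Y -ₚ Y)
  rearrange = solve-∀ poly-ring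
  rearrange′ : ∀ Y Z → Y -ₚ 1ₚ +ₚ (Z -ₚ Y) ≋ Z -ₚ 1ₚ
  rearrange′ = solve-∀ poly-ring

X^-geo : ∀ a n → X^ (a ℕ.* n) ≋ 1ₚ +ₚ (X^ a -ₚ 1ₚ) *ₚ geo a n
X^-geo a n = ≋-trans (rearrange (X^ (a ℕ.* n))) (+ₚ-cong ≋-refl (≋-sym (geo-telescope a n)))
  where
  rearrange : ∀ Y → Y ≋ 1ₚ +ₚ (Y -ₚ 1ₚ)
  rearrange = solve-∀ poly-ring

-- Coefficients that are indicators of a property

-- The value comes together with a decision of `P`, so polynomials with 0-1 coefficients are
-- compared by comparing properties of exponents.
Indicator : Set → ℚ → Set
Indicator P x = (P × x ≡ 1ℚ) ⊎ (¬ P × x ≡ 0ℚ)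

Indicator-map : ∀ {P Q x} → (P → Q) → (Q → P) → Indicator P x → Indicator Q x
Indicator-map f g (inj₁ (h , e)) = inj₁ (f h , e)
Indicator-map f g (inj₂ (h , e)) = inj₂ (h ∘ g , e)

Indicator-resp : ∀ {P x y} → x ≡ y → Indicator P x → Indicator P y
Indicator-resp refl h = h

Indicator-+ : ∀ {P Q x y} → ¬ (P × Q) → Indicator P x → Indicator Q y → Indicator (P ⊎ Q) (x ℚ.+ y)
Indicator-+ d (inj₁ (h , refl)) (inj₁ (k , refl)) = contradiction (h , k) d
Indicator-+ d (inj₁ (h , refl)) (inj₂ (k , refl)) = inj₁ (inj₁ h , refl)
Indicator-+ d (inj₂ (h , refl)) (inj₁ (k , refl)) = inj₁ (inj₂ k , refl)
Indicator-+ d (inj₂ (h , refl)) (inj₂ (k , refl)) = inj₂ ([ h , k ]′ , refl)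

Indicator-1 : ∀ {P x} → P → Indicator P x → x ≡ 1ℚ
Indicator-1 h (inj₁ (_ , e)) = e
Indicator-1 h (inj₂ (k , _)) = contradiction h k

Indicator-0 : ∀ {P x} → ¬ P → Indicator P x → x ≡ 0ℚ
Indicator-0 h (inj₁ (k , _)) = contradiction k h
Indicator-0 h (inj₂ (_ , e)) = e

Indicator-unique : ∀ {P x y} → Indicator P x → Indicator P y → x ≡ y
Indicator-unique (inj₁ (h , e)) i = trans e (sym (Indicator-1 h i))
Indicator-unique (inj₂ (h , e)) i = trans e (sym (Indicator-0 h i))

Below : ℕ → (ℕ → Set) → Set
Below n P = ∃ λ j → j ℕ.< n × P j

-- At most one summand contributes at `i`, which keeps the coefficient of the sum at 0 or 1.
sumₚ-indicator : ∀ (f : ℕ → Poly) (P : ℕ → Set) i n →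
  (∀ j → j ℕ.< n → Indicator (P j) (coeff (f j) i)) →
  (∀ j k → j ℕ.< k → k ℕ.< n → P j → ¬ P k) →
  Indicator (Below n P) (coeff (sumₚ f n) i)
sumₚ-indicator f P i zero ind excl = inj₂ ((λ { (_ , () , _) }) , refl)
sumₚ-indicator f P i (suc n) ind excl = Indicator-resp (sym (coeff-+ (sumₚ f n) (f n) i))
  (Indicator-map to from (Indicator-+
    (λ { ((j , j<n , Pj) , Pn) → excl j n j<n ℕₚ.≤-refl Pj Pn })
    (sumₚ-indicator f P i n (λ j j<n → ind j (ℕₚ.m<n⇒m<1+n j<n))
      (λ j k j<k k<n → excl j k j<k (ℕₚ.m<n⇒m<1+n k<n)))
    (ind n ℕₚ.≤-refl)))
  where
  to : Below n P ⊎ P n → Below (suc n) P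
  to (inj₁ (j , j<n , Pj)) = j , ℕₚ.m<n⇒m<1+n j<n , Pj
  to (inj₂ Pn) = n , ℕₚ.≤-refl , Pn
  from : Below (suc n) P → Below n P ⊎ P n
  from (j , s≤s j≤n , Pj) with ℕₚ.m≤n⇒m<n∨m≡n j≤n
  ... | inj₁ j<n = inj₁ (j , j<n , Pj)
  ... | inj₂ refl = inj₂ Pj

X^-indicator : ∀ n i → Indicator (i ≡ n) (coeff (X^ n) i)
X^-indicator n i with i ℕₚ.≟ n
... | yes refl = inj₁ (refl , coeff-X^ n)
... | no i≢n = inj₂ (i≢n , coeff-X^-≢ i≢n)

ones-indicator : ∀ n i → Indicator (i ℕ.< n) (coeff (ones n) i)
ones-indicator zero i = inj₂ ((λ ()) , refl)
ones-indicator (suc n) zero = inj₁ (s≤s z≤n , refl)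
ones-indicator (suc n) (suc i) = Indicator-map s≤s ℕ.s≤s⁻¹ (ones-indicator n i)

DegLt-ones : ∀ n → DegLt (ones n) n
DegLt-ones n i n≤i = Indicator-0 (ℕₚ.≤⇒≯ n≤i) (ones-indicator n i)

geo-indicator : ∀ a .{{_ : NonZero a}} n i → Indicator (Below n (λ j → i ≡ a ℕ.* j)) (coeff (geo a n) i)
geo-indicator a n i = sumₚ-indicator _ _ i n (λ j _ → X^-indicator (a ℕ.* j) i)
  (λ j k j<k _ e f → ℕₚ.<⇒≢ j<k (ℕₚ.*-cancelˡ-≡ j k a (trans (sym e) f)))

X^*-indicator : ∀ s {A P} → (∀ i → Indicator (P i) (coeff A i)) →
  ∀ i → Indicator (∃ λ k → i ≡ s ℕ.+ k × P k) (coeff (X^ s *ₚ A) i)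
X^*-indicator s {A} {P} ind i with s ℕ.≤? i
... | no s≰i = inj₂ ((λ { (k , refl , _) → s≰i (ℕₚ.m≤m+n s k) }) , X^*-coeff-< s A i (ℕₚ.≰⇒> s≰i))
... | yes s≤i = Indicator-resp (sym (X^*-coeff-≥ s A i s≤i))
  (Indicator-map (λ h → i ∸ s , sym (ℕₚ.m+[n∸m]≡n s≤i) , h)
    (λ { (k , refl , h) → subst P (sym (ℕₚ.m+n∸m≡n s k)) h }) (ind (i ∸ s)))

-- Reducing the exponents of 1 + X^a + ⋯ + X^(a(m-1)) modulo n

module Fold (n a : ℕ) .{{_ : NonZero n}} where

  residue : ℕ → ℕ
  residue j = (j ℕ.* a) ℕ.% n

  -- Division of `geo a m` by X^n - 1, term by term: X^(s + n t) leaves X^s, with cofactor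
  -- `X^ s *ₚ geo n t`.
  remainder quotient : ℕ → Poly
  remainder = sumₚ (λ j → X^ (residue j))
  quotient = sumₚ (λ j → X^ (residue j) *ₚ geo n ((j ℕ.* a) ℕ./ n))

  geo-fold : ∀ m → geo a m ≋ remainder m +ₚ (X^ n -ₚ 1ₚ) *ₚ quotient m
  geo-fold zero = ≋-sym (*ₚ-zeroʳ (X^ n -ₚ 1ₚ))
  geo-fold (suc m) = begin
    geo a m +ₚ X^ (a ℕ.* m)
      ≈⟨ +ₚ-cong (geo-fold m) step ⟩
    (remainder m +ₚ (X^ n -ₚ 1ₚ) *ₚ quotient m) +ₚ X^ s *ₚ (1ₚ +ₚ (X^ n -ₚ 1ₚ) *ₚ geo n t)
      ≈⟨ rearrange (remainder m) (X^ n -ₚ 1ₚ) (quotient m) (X^ s) (geo n t) ⟩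
    (remainder m +ₚ X^ s) +ₚ (X^ n -ₚ 1ₚ) *ₚ (quotient m +ₚ X^ s *ₚ geo n t) ∎
    where
    open ≋-Reasoning
    s = residue m
    t = (m ℕ.* a) ℕ./ n
    step : X^ (a ℕ.* m) ≋ X^ s *ₚ (1ₚ +ₚ (X^ n -ₚ 1ₚ) *ₚ geo n t)
    step = begin
      X^ (a ℕ.* m)           ≡⟨ cong X^ (trans (ℕₚ.*-comm a m) (trans (ℕ.m≡m%n+[m/n]*n (m ℕ.* a) n) (cong (s ℕ.+_) (ℕₚ.*-comm t n)))) ⟩
      X^ (s ℕ.+ n ℕ.* t)     ≈⟨ X^-+ s (n ℕ.* t) ⟨
      X^ s *ₚ X^ (n ℕ.* t)   ≈⟨ *ₚ-congʳ (X^ s) (X^-geo n t) ⟩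
      X^ s *ₚ (1ₚ +ₚ (X^ n -ₚ 1ₚ) *ₚ geo n t) ∎
    rearrange : ∀ R M Q S Y → (R +ₚ M *ₚ Q) +ₚ S *ₚ (1ₚ +ₚ M *ₚ Y) ≋ (R +ₚ S) +ₚ M *ₚ (Q +ₚ S *ₚ Y)
    rearrange = solve-∀ poly-ring

  module _ (residue-injective : ∀ j k → j ℕ.< k → k ℕ.< n → residue j ≢ residue k) where

    remainder-indicator : ∀ m → m ℕ.≤ n → ∀ i → Indicator (Below m (λ j → i ≡ residue j)) (coeff (remainder m) i)
    remainder-indicator m m≤n i = sumₚ-indicator _ _ i m (λ j _ → X^-indicator (residue j) i)
      (λ j k j<k k<m e f → residue-injective j k j<k (ℕₚ.<-≤-trans k<m m≤n) (trans (sym e) f))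

    -- The exponents in the term of index `j` are s, s + n, and so on up to but excluding s + n t =
    -- j a: the members of the residue class of j a that lie below j a. Distinct `j` give distinct
    -- classes.
    quotient-indicator : ∀ m → m ℕ.≤ n → ∀ i →
      Indicator (Below m (λ j → i ℕ.< j ℕ.* a × i ℕ.% n ≡ residue j)) (coeff (quotient m) i)
    quotient-indicator m m≤n i = sumₚ-indicator _ _ i m (λ j _ → term j)
      (λ j k j<k k<m (_ , e) (_ , f) → residue-injective j k j<k (ℕₚ.<-≤-trans k<m m≤n) (trans (sym e) f))
      where
      term : ∀ j → Indicator (i ℕ.< j ℕ.* a × i ℕ.% n ≡ residue j) (coeff (X^ (residue j) *ₚ geo n ((j ℕ.* a) ℕ./ n)) i)
      term j = Indicator-map to from (X^*-indicator s (geo-indicator n t) i)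
        where
        s = residue j
        t = (j ℕ.* a) ℕ./ n
        ja≡ : j ℕ.* a ≡ s ℕ.+ n ℕ.* t
        ja≡ = trans (ℕ.m≡m%n+[m/n]*n (j ℕ.* a) n) (cong (s ℕ.+_) (ℕₚ.*-comm t n))
        to : (∃ λ k → i ≡ s ℕ.+ k × Below t (λ l → k ≡ n ℕ.* l)) → i ℕ.< j ℕ.* a × i ℕ.% n ≡ s
        to (_ , refl , l , l<t , refl) =
          subst (s ℕ.+ n ℕ.* l ℕ.<_) (sym ja≡) (ℕₚ.+-monoʳ-< s (ℕₚ.*-monoʳ-< n l<t)) ,
          trans (cong (λ x → (s ℕ.+ x) ℕ.% n) (ℕₚ.*-comm n l))
            (trans (ℕ.[m+kn]%n≡m%n s l n) (ℕ.m%n%n≡m%n (j ℕ.* a) n))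
        from : i ℕ.< j ℕ.* a × i ℕ.% n ≡ s → ∃ λ k → i ≡ s ℕ.+ k × Below t (λ l → k ≡ n ℕ.* l)
        from (i<ja , i%n≡s) = n ℕ.* (i ℕ./ n) , i≡ , i ℕ./ n ,
          ℕₚ.*-cancelˡ-< n (i ℕ./ n) t (ℕₚ.+-cancelˡ-< s _ _ (subst₂ ℕ._<_ i≡ ja≡ i<ja)) , refl
          where
          i≡ : i ≡ s ℕ.+ n ℕ.* (i ℕ./ n)
          i≡ = trans (ℕ.m≡m%n+[m/n]*n i n) (cong₂ ℕ._+_ i%n≡s (ℕₚ.*-comm (i ℕ./ n) n))

-- Multiplication by X^a - 1 is injective

telescope-coeff : ∀ a A i → coeff ((X^ a -ₚ 1ₚ) *ₚ A) (a ℕ.+ i) ≡ coeff A i ℚ.- coeff A (a ℕ.+ i)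
telescope-coeff a A i = begin
  coeff ((X^ a -ₚ 1ₚ) *ₚ A) (a ℕ.+ i)                       ≡⟨ at (rearrange (X^ a) A) (a ℕ.+ i) ⟩
  coeff (X^ a *ₚ A -ₚ A) (a ℕ.+ i)                          ≡⟨ coeff-- (X^ a *ₚ A) A (a ℕ.+ i) ⟩
  coeff (X^ a *ₚ A) (a ℕ.+ i) ℚ.- coeff A (a ℕ.+ i)         ≡⟨ cong (λ x → x ℚ.- coeff A (a ℕ.+ i)) (X^*-coeff a A i) ⟩
  coeff A i ℚ.- coeff A (a ℕ.+ i)                           ∎
  where
  open ≡-Reasoning
  rearrange : ∀ X A → (X -ₚ 1ₚ) *ₚ A ≋ X *ₚ A -ₚ A
  rearrange = solve-∀ poly-ring

DegLt-length : ∀ A → DegLt A (length A)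
DegLt-length [] i _ = refl
DegLt-length (a ∷ A) (suc i) (s≤s l≤i) = DegLt-length A i l≤i

-- The coefficients of A beyond n are periodic, hence zero.
DegLt-telescope : ∀ a .{{_ : NonZero a}} A n → DegLt ((X^ a -ₚ 1ₚ) *ₚ A) (a ℕ.+ n) → DegLt A n
DegLt-telescope a A n d i n≤i = trans (periodic (length A))
  (DegLt-length A _ (ℕₚ.≤-trans (ℕₚ.m≤m*n (length A) a) (ℕₚ.m≤m+n (length A ℕ.* a) i)))
  where
  periodic : ∀ k → coeff A i ≡ coeff A (k ℕ.* a ℕ.+ i)
  periodic zero = refl
  periodic (suc k) = trans (periodic k) (trans
    (p-q≡0⇒p≡q _ _ (trans (sym (telescope-coeff a A (k ℕ.* a ℕ.+ i)))
      (d _ (ℕₚ.+-monoʳ-≤ a (ℕₚ.≤-trans n≤i (ℕₚ.m≤n+m i (k ℕ.* a)))))))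
    (cong (coeff A) (sym (ℕₚ.+-assoc a (k ℕ.* a) i))))

-- `DegLt-telescope` with bound 0: a polynomial killed by X^a - 1 is zero.
telescope-cancel : ∀ a .{{_ : NonZero a}} A B → (X^ a -ₚ 1ₚ) *ₚ A ≋ (X^ a -ₚ 1ₚ) *ₚ B → A ≋ B
telescope-cancel a A B e = by-coeff λ i →
  p-q≡0⇒p≡q _ _ (trans (sym (coeff-- A B i)) (DegLt-telescope a (A -ₚ B) 0 zeros i z≤n))
  where
  zero-difference : (X^ a -ₚ 1ₚ) *ₚ (A -ₚ B) ≋ []
  zero-difference = begin
    (X^ a -ₚ 1ₚ) *ₚ (A -ₚ B)                        ≈⟨ rearrange (X^ a -ₚ 1ₚ) A B ⟩
    (X^ a -ₚ 1ₚ) *ₚ A -ₚ (X^ a -ₚ 1ₚ) *ₚ B          ≈⟨ +ₚ-cong e ≋-refl ⟩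
    (X^ a -ₚ 1ₚ) *ₚ B -ₚ (X^ a -ₚ 1ₚ) *ₚ B          ≈⟨ -ₚ-inverseʳ ((X^ a -ₚ 1ₚ) *ₚ B) ⟩
    []                                              ∎
    where
    open ≋-Reasoning
    rearrange : ∀ M A B → M *ₚ (A -ₚ B) ≋ M *ₚ A -ₚ M *ₚ B
    rearrange = solve-∀ poly-ring
  zeros : DegLt ((X^ a -ₚ 1ₚ) *ₚ (A -ₚ B)) (a ℕ.+ 0)
  zeros i _ = at zero-difference i

-- Integers in ℚ

toℚᵘ-/ : ∀ z n → ℚ.toℚᵘ (z / suc n) ℚᵘ.≃ mkℚᵘ z n
toℚᵘ-/ z n = ℚₚ.toℚᵘ-fromℚᵘ (mkℚᵘ z n)

-- Forming `z / 1` normalises through a gcd, which is stuck on variables; among unnormalised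
-- rationals the identity is integer arithmetic.
ℤ→ℚ-+ : ∀ a b → ℤ→ℚ (a ℤ.+ b) ≡ ℤ→ℚ a ℚ.+ ℤ→ℚ b
ℤ→ℚ-+ a b = ℚₚ.toℚᵘ-injective (begin
  ℚ.toℚᵘ (ℤ→ℚ (a ℤ.+ b))                      ≈⟨ toℚᵘ-/ (a ℤ.+ b) 0 ⟩
  mkℚᵘ (a ℤ.+ b) 0                            ≈⟨ *≡* (cong (ℤ._* + 1) (cong₂ ℤ._+_ (sym (ℤₚ.*-identityʳ a)) (sym (ℤₚ.*-identityʳ b)))) ⟩
  mkℚᵘ a 0 ℚᵘ.+ mkℚᵘ b 0                      ≈⟨ ℚᵘₚ.+-cong (toℚᵘ-/ a 0) (toℚᵘ-/ b 0) ⟨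
  ℚ.toℚᵘ (ℤ→ℚ a) ℚᵘ.+ ℚ.toℚᵘ (ℤ→ℚ b)          ≈⟨ ℚₚ.toℚᵘ-homo-+ (ℤ→ℚ a) (ℤ→ℚ b) ⟨
  ℚ.toℚᵘ (ℤ→ℚ a ℚ.+ ℤ→ℚ b)                    ∎)
  where open ℚᵘₚ.≃-Reasoning

ℤ→ℚ-neg : ∀ a → ℤ→ℚ (ℤ.- a) ≡ ℚ.- ℤ→ℚ a
ℤ→ℚ-neg a = begin
  ℤ→ℚ (ℤ.- a)                                     ≡⟨ ℚₚ.+-identityʳ (ℤ→ℚ (ℤ.- a)) ⟨
  ℤ→ℚ (ℤ.- a) ℚ.+ 0ℚ                              ≡⟨ cong (ℤ→ℚ (ℤ.- a) ℚ.+_) (ℚₚ.+-inverseʳ (ℤ→ℚ a)) ⟨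
  ℤ→ℚ (ℤ.- a) ℚ.+ (ℤ→ℚ a ℚ.- ℤ→ℚ a)               ≡⟨ ℚₚ.+-assoc (ℤ→ℚ (ℤ.- a)) (ℤ→ℚ a) (ℚ.- ℤ→ℚ a) ⟨
  ℤ→ℚ (ℤ.- a) ℚ.+ ℤ→ℚ a ℚ.- ℤ→ℚ a                 ≡⟨ cong (ℚ._- ℤ→ℚ a) (ℤ→ℚ-+ (ℤ.- a) a) ⟨
  ℤ→ℚ (ℤ.- a ℤ.+ a) ℚ.- ℤ→ℚ a                     ≡⟨ cong (λ z → ℤ→ℚ z ℚ.- ℤ→ℚ a) (ℤₚ.+-inverseˡ a) ⟩
  0ℚ ℚ.- ℤ→ℚ a                                    ≡⟨ ℚₚ.+-identityˡ (ℚ.- ℤ→ℚ a) ⟩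
  ℚ.- ℤ→ℚ a                                       ∎
  where open ≡-Reasoning

ℕ→ℚ-suc : ∀ n → ℕ→ℚ (suc n) ≡ 1ℚ ℚ.+ ℕ→ℚ n
ℕ→ℚ-suc n = ℤ→ℚ-+ (+ 1) (+ n)

recip-* : ∀ n .{{_ : NonZero n}} → recipℕ n ℚ.* ℕ→ℚ n ≡ 1ℚ
recip-* (suc n) = ℚₚ.toℚᵘ-injective (begin
  ℚ.toℚᵘ (recipℕ (suc n) ℚ.* ℕ→ℚ (suc n))                  ≈⟨ ℚₚ.toℚᵘ-homo-* (recipℕ (suc n)) (ℕ→ℚ (suc n)) ⟩
  ℚ.toℚᵘ (recipℕ (suc n)) ℚᵘ.* ℚ.toℚᵘ (ℕ→ℚ (suc n))        ≈⟨ ℚᵘₚ.*-cong (toℚᵘ-/ (+ 1) n) (toℚᵘ-/ (+ suc n) 0) ⟩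
  mkℚᵘ (+ 1) n ℚᵘ.* mkℚᵘ (+ suc n) 0                       ≈⟨ *≡* eq ⟩
  ℚ.toℚᵘ 1ℚ                                                ∎)
  where
  open ℚᵘₚ.≃-Reasoning
  eq : (+ 1 ℤ.* + suc n) ℤ.* + 1 ≡ + 1 ℤ.* + (suc n ℕ.* 1)
  eq = trans (ℤₚ.*-identityʳ _) (cong (λ m → + 1 ℤ.* + m) (sym (ℕₚ.*-identityʳ (suc n))))

-- Residues of the multiples of a unit

%≡%⇒∣∸ : ∀ x y n .{{_ : NonZero n}} → x ℕ.% n ≡ y ℕ.% n → n ∣ y ∸ x
%≡%⇒∣∸ x y n e = divides (y ℕ./ n ∸ x ℕ./ n) (begin
  y ∸ x                                                              ≡⟨ cong₂ _∸_ (ℕ.m≡m%n+[m/n]*n y n) (ℕ.m≡m%n+[m/n]*n x n) ⟩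
  (y ℕ.% n ℕ.+ y ℕ./ n ℕ.* n) ∸ (x ℕ.% n ℕ.+ x ℕ./ n ℕ.* n)          ≡⟨ cong (λ s → (y ℕ.% n ℕ.+ y ℕ./ n ℕ.* n) ∸ (s ℕ.+ x ℕ./ n ℕ.* n)) e ⟩
  (y ℕ.% n ℕ.+ y ℕ./ n ℕ.* n) ∸ (y ℕ.% n ℕ.+ x ℕ./ n ℕ.* n)          ≡⟨ ℕₚ.[m+n]∸[m+o]≡n∸o (y ℕ.% n) _ _ ⟩
  y ℕ./ n ℕ.* n ∸ x ℕ./ n ℕ.* n                                      ≡⟨ ℕₚ.*-distribʳ-∸ n (y ℕ./ n) (x ℕ./ n) ⟨
  (y ℕ./ n ∸ x ℕ./ n) ℕ.* n                                          ∎)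
  where open ≡-Reasoning

module Unit {n a : ℕ} .{{_ : NonZero n}} (1<n : 1 ℕ.< n) (coprime : Coprime n a) where

  -- Equal residues make `n` divide `a * (k ∸ j)`, hence `k ∸ j` by coprimality, although 0 < k - j
  -- < n.
  residue-injective : ∀ j k → j ℕ.< k → k ℕ.< n → (j ℕ.* a) ℕ.% n ≢ (k ℕ.* a) ℕ.% n
  residue-injective j k j<k k<n e = ℕₚ.<-irrefl refl (ℕₚ.<-≤-trans k<n (ℕₚ.≤-trans n≤k∸j (ℕₚ.m∸n≤m k j)))
    where
    n∣a*[k∸j] : n ∣ a ℕ.* (k ∸ j)
    n∣a*[k∸j] = subst (n ∣_) (trans (sym (ℕₚ.*-distribʳ-∸ a k j)) (ℕₚ.*-comm (k ∸ j) a))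
      (%≡%⇒∣∸ (j ℕ.* a) (k ℕ.* a) n e)
    n≤k∸j : n ℕ.≤ k ∸ j
    n≤k∸j = ∣⇒≤ {{ℕ.>-nonZero (ℕₚ.m<n⇒0<n∸m j<k)}} (coprime-divisor coprime n∣a*[k∸j])

  [1+kn]%n≡1 : ∀ k → (1 ℕ.+ k ℕ.* n) ℕ.% n ≡ 1
  [1+kn]%n≡1 k = trans (ℕ.[m+kn]%n≡m%n 1 k n) (ℕ.m<n⇒m%n≡m 1<n)

  left-inverse : ∃ λ m → (m ℕ.* a) ℕ.% n ≡ 1
  left-inverse with coprime-Bézout (Coprimality.sym coprime)
  ... | Bézout.+- x y eq = x , trans (cong (ℕ._% n) (sym eq)) ([1+kn]%n≡1 y)
  -- Here `x * a` is -1 modulo `n`; multiplying by n - 1, again -1, yields 1.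
  ... | Bézout.-+ x y eq = k ℕ.* x , (begin
    (k ℕ.* x ℕ.* a) ℕ.% n                  ≡⟨ ℕ.[m+n]%n≡m%n (k ℕ.* x ℕ.* a) n ⟨
    (k ℕ.* x ℕ.* a ℕ.+ n) ℕ.% n            ≡⟨ cong (ℕ._% n) shift ⟩
    (1 ℕ.+ (k ℕ.* y) ℕ.* n) ℕ.% n          ≡⟨ [1+kn]%n≡1 (k ℕ.* y) ⟩
    1                                      ∎)
    where
    open ≡-Reasoning
    k = ℕ.pred n
    shift : k ℕ.* x ℕ.* a ℕ.+ n ≡ 1 ℕ.+ (k ℕ.* y) ℕ.* n
    shift = begin
      k ℕ.* x ℕ.* a ℕ.+ n                      ≡⟨ cong₂ ℕ._+_ (ℕₚ.*-assoc k x a) (sym (ℕₚ.suc-pred n)) ⟩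
      k ℕ.* (x ℕ.* a) ℕ.+ suc k                ≡⟨ ℕₚ.+-suc (k ℕ.* (x ℕ.* a)) k ⟩
      suc (k ℕ.* (x ℕ.* a) ℕ.+ k)              ≡⟨ cong suc (ℕₚ.+-comm (k ℕ.* (x ℕ.* a)) k) ⟩
      suc (k ℕ.+ k ℕ.* (x ℕ.* a))              ≡⟨ cong suc (ℕₚ.*-suc k (x ℕ.* a)) ⟨
      suc (k ℕ.* (1 ℕ.+ x ℕ.* a))              ≡⟨ cong (λ z → suc (k ℕ.* z)) eq ⟩
      suc (k ℕ.* (y ℕ.* n))                    ≡⟨ cong suc (ℕₚ.*-assoc k y n) ⟨
      suc ((k ℕ.* y) ℕ.* n)                    ∎

  %*-% : ∀ x y → ((x ℕ.% n) ℕ.* y) ℕ.% n ≡ (x ℕ.* y) ℕ.% n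
  %*-% x y = begin
    ((x ℕ.% n) ℕ.* y) ℕ.% n                            ≡⟨ ℕ.%-distribˡ-* (x ℕ.% n) y n ⟩
    ((x ℕ.% n ℕ.% n) ℕ.* (y ℕ.% n)) ℕ.% n              ≡⟨ cong (λ z → (z ℕ.* (y ℕ.% n)) ℕ.% n) (ℕ.m%n%n≡m%n x n) ⟩
    ((x ℕ.% n) ℕ.* (y ℕ.% n)) ℕ.% n                    ≡⟨ ℕ.%-distribˡ-* x y n ⟨
    (x ℕ.* y) ℕ.% n                                    ∎
    where open ≡-Reasoning

  inverse : ∃ λ m → m ℕ.< n × ∃ λ t → m ℕ.* a ≡ 1 ℕ.+ t ℕ.* n
  inverse with left-inverse
  ... | x , e = m , ℕ.m%n<n x n , (m ℕ.* a) ℕ./ n ,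
    trans (ℕ.m≡m%n+[m/n]*n (m ℕ.* a) n) (cong (ℕ._+ (m ℕ.* a) ℕ./ n ℕ.* n) (trans (%*-% x a) e))
    where m = x ℕ.% n

  residue-surjective : ∀ i → i ℕ.< n → ∃ λ j → j ℕ.< n × i ≡ (j ℕ.* a) ℕ.% n
  residue-surjective i i<n with inverse
  -- The preimage of `i` is `i` times the inverse of `a`, reduced modulo `n`.
  ... | m , _ , t , e = (i ℕ.* m) ℕ.% n , ℕ.m%n<n (i ℕ.* m) n , sym (begin
    (((i ℕ.* m) ℕ.% n) ℕ.* a) ℕ.% n          ≡⟨ %*-% (i ℕ.* m) a ⟩
    (i ℕ.* m ℕ.* a) ℕ.% n                    ≡⟨ cong (ℕ._% n) (trans (ℕₚ.*-assoc i m a) (cong (i ℕ.*_) e)) ⟩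
    (i ℕ.* (1 ℕ.+ t ℕ.* n)) ℕ.% n            ≡⟨ cong (ℕ._% n) (trans (ℕₚ.*-suc i (t ℕ.* n)) (cong (i ℕ.+_) (sym (ℕₚ.*-assoc i t n)))) ⟩
    (i ℕ.+ i ℕ.* t ℕ.* n) ℕ.% n              ≡⟨ ℕ.[m+kn]%n≡m%n i (i ℕ.* t) n ⟩
    i ℕ.% n                                  ≡⟨ ℕ.m<n⇒m%n≡m i<n ⟩
    i                                        ∎)
    where open ≡-Reasoning

-- Prime numbers and their products

prime⇒1< : ∀ {p} → Prime p → 1 ℕ.< p
prime⇒1< {suc (suc p)} _ = s≤s (s≤s z≤n)
prime⇒1< {zero} pr = contradiction (prime⇒nonTrivial pr) λ ()
prime⇒1< {suc zero} pr = contradiction (prime⇒nonTrivial pr) λ ()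

∤⇒coprime : ∀ {p n} → Prime p → ¬ p ∣ n → Coprime p n
∤⇒coprime p-prime p∤n (d∣p , d∣n) with prime⇒irreducible p-prime d∣p
... | inj₁ d≡1 = d≡1
... | inj₂ refl = contradiction d∣n p∤n

distinct-primes-∤ : ∀ {p r} → Prime p → Prime r → p ≢ r → ¬ p ∣ r
distinct-primes-∤ p-prime r-prime p≢r p∣r with prime⇒irreducible r-prime p∣r
... | inj₁ refl = ℕₚ.<-irrefl refl (prime⇒1< p-prime)
... | inj₂ p≡r = p≢r p≡r

-- If p does not divide d, then d is coprime to p and divides r; otherwise d is c p with c dividing
-- r.
divisors-pr : ∀ {p r d} → Prime p → Prime r → d ∣ p ℕ.* r → d ≡ 1 ⊎ d ≡ p ⊎ d ≡ r ⊎ d ≡ p ℕ.* r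
divisors-pr {p} {r} {d} p-prime r-prime d∣pr with p ∣? d
... | no p∤d with prime⇒irreducible r-prime (coprime-divisor (Coprimality.sym (∤⇒coprime p-prime p∤d)) d∣pr)
...   | inj₁ d≡1 = inj₁ d≡1
...   | inj₂ d≡r = inj₂ (inj₂ (inj₁ d≡r))
divisors-pr {p} {r} {.(c ℕ.* p)} p-prime r-prime d∣pr | yes (divides-refl c)
  with prime⇒irreducible r-prime (*-cancelˡ-∣ p {{prime⇒nonZero p-prime}} (subst (_∣ p ℕ.* r) (ℕₚ.*-comm c p) d∣pr))
... | inj₁ refl = inj₂ (inj₁ (ℕₚ.*-identityˡ p))
... | inj₂ refl = inj₂ (inj₂ (inj₂ (ℕₚ.*-comm c p)))

-- Lower bounds for the totient

Unique-⊆-length : ∀ {xs ys : List ℕ} → Unique xs → (∀ {x} → x ∈ xs → x ∈ ys) → length xs ℕ.≤ length ys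
Unique-⊆-length {[]} _ _ = z≤n
Unique-⊆-length {x ∷ xs} (x∉ ∷ unique) xs⊆ys with ∈-∃++ (xs⊆ys (here refl))
... | as , bs , refl = begin
  suc (length xs)                        ≤⟨ s≤s (Unique-⊆-length unique xs⊆as++bs) ⟩
  suc (length (as ++ bs))                ≡⟨ cong suc (Listₚ.length-++ as) ⟩
  suc (length as ℕ.+ length bs)          ≡⟨ ℕₚ.+-suc (length as) (length bs) ⟨
  length as ℕ.+ suc (length bs)          ≡⟨ Listₚ.length-++ as ⟨
  length (as ++ [ x ] ++ bs)             ∎
  where
  open ℕₚ.≤-Reasoning
  xs⊆as++bs : ∀ {y} → y ∈ xs → y ∈ as ++ bs
  xs⊆as++bs y∈xs with ∈-++⁻ as (xs⊆ys (there y∈xs))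
  ... | inj₁ y∈as = ∈-++⁺ˡ y∈as
  ... | inj₂ (here refl) = contradiction refl (All.lookup x∉ y∈xs)
  ... | inj₂ (there y∈bs) = ∈-++⁺ʳ as y∈bs

1…_ : ℕ → List ℕ
1… n = map suc (upTo n)

∈-1…⁺ : ∀ {k n} → 0 ℕ.< k → k ℕ.≤ n → k ∈ 1… n
∈-1…⁺ {suc k} _ k<n = ∈-map⁺ suc (∈-upTo⁺ k<n)

∈-1…⁻ : ∀ {k n} → k ∈ 1… n → 0 ℕ.< k × k ℕ.≤ n
∈-1…⁻ k∈ with ∈-map⁻ suc k∈
... | _ , i∈ , refl = s≤s z≤n , ∈-upTo⁻ i∈

length-1… : ∀ n → length (1… n) ≡ n
length-1… n = trans (Listₚ.length-map suc (upTo n)) (Listₚ.length-upTo n)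

Unique-1… : ∀ n → Unique (1… n)
Unique-1… n = Uniqueₚ.map⁺ ℕₚ.suc-injective (Uniqueₚ.upTo⁺ n)

φ-prime-≥ : ∀ {p} → Prime p → ℕ.pred p ℕ.≤ φ p
φ-prime-≥ {zero} _ = z≤n
φ-prime-≥ {p@(suc p′)} p-prime = subst (ℕ._≤ φ p) (length-1… p′)
  (Unique-⊆-length (Unique-1… p′) λ k∈ → let 0<k , k≤p′ = ∈-1…⁻ k∈ in
    ∈-filter⁺ (λ k → coprime? k p) (∈-1…⁺ 0<k (ℕₚ.m≤n⇒m≤1+n k≤p′))
      (Coprimality.sym (∤⇒coprime p-prime λ p∣k → ℕₚ.<⇒≱ (s≤s k≤p′) (∣⇒≤ {{ℕ.>-nonZero 0<k}} p∣k))))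

-- Each number from 1 to pr - 1 is coprime to pr, or one of r - 1 multiples of p, or one of p - 1
-- multiples of r; and pr - 1 exceeds (r - 1) + (p - 1) by (p - 1)(r - 1).
φ-pr-≥ : ∀ {p r} → Prime p → Prime r → ℕ.pred p ℕ.* ℕ.pred r ℕ.≤ φ (p ℕ.* r)
φ-pr-≥ {zero} _ _ = z≤n
φ-pr-≥ {p@(suc p′)} {zero} _ _ rewrite ℕₚ.*-zeroʳ p′ = z≤n
φ-pr-≥ {p@(suc p′)} {r@(suc r′)} p-prime r-prime = ℕₚ.+-cancelʳ-≤ (r′ ℕ.+ p′) _ _ (begin
  p′ ℕ.* r′ ℕ.+ (r′ ℕ.+ p′)                                       ≡⟨ count ⟩
  pr-1                                                            ≡⟨ length-1… pr-1 ⟨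
  length (1… pr-1)                                                ≤⟨ Unique-⊆-length (Unique-1… pr-1) covered ⟩
  length (units ++ map (p ℕ.*_) (1… r′) ++ map (r ℕ.*_) (1… p′))  ≡⟨ lengths ⟩
  φ (p ℕ.* r) ℕ.+ (r′ ℕ.+ p′)                                     ∎)
  where
  open ℕₚ.≤-Reasoning
  pr-1 = r′ ℕ.+ p′ ℕ.* r
  units = filter (λ k → coprime? k (p ℕ.* r)) (1… (p ℕ.* r))
  count : p′ ℕ.* r′ ℕ.+ (r′ ℕ.+ p′) ≡ pr-1
  count = trans (ℕₚ.+-comm (p′ ℕ.* r′) (r′ ℕ.+ p′)) (trans (ℕₚ.+-assoc r′ p′ (p′ ℕ.* r′)) (cong (r′ ℕ.+_) (sym (ℕₚ.*-suc p′ r′))))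
  lengths : length (units ++ map (p ℕ.*_) (1… r′) ++ map (r ℕ.*_) (1… p′)) ≡ φ (p ℕ.* r) ℕ.+ (r′ ℕ.+ p′)
  lengths = trans (Listₚ.length-++ units) (cong (φ (p ℕ.* r) ℕ.+_) (trans (Listₚ.length-++ (map (p ℕ.*_) (1… r′)))
    (cong₂ ℕ._+_ (trans (Listₚ.length-map (p ℕ.*_) (1… r′)) (length-1… r′)) (trans (Listₚ.length-map (r ℕ.*_) (1… p′)) (length-1… p′)))))
  multiple : ∀ a b c → 0 ℕ.< c ℕ.* a → c ℕ.* a ℕ.< a ℕ.* suc b → c ℕ.* a ∈ map (a ℕ.*_) (1… b)
  multiple a b zero ()
  multiple a b (suc c) _ ca<ab = subst (_∈ map (a ℕ.*_) (1… b)) (ℕₚ.*-comm a (suc c)) (∈-map⁺ (a ℕ.*_)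
    (∈-1…⁺ (s≤s z≤n) (ℕ.s≤s⁻¹ (ℕₚ.*-cancelˡ-< a (suc c) (suc b) (subst (ℕ._< a ℕ.* suc b) (ℕₚ.*-comm (suc c) a) ca<ab)))))
  covered : ∀ {k} → k ∈ 1… pr-1 → k ∈ units ++ map (p ℕ.*_) (1… r′) ++ map (r ℕ.*_) (1… p′)
  covered {k} k∈ with 0<k , k≤ ← ∈-1…⁻ k∈ with p ∣? k | r ∣? k
  ... | yes (divides c refl) | _ = ∈-++⁺ʳ units (∈-++⁺ˡ (multiple p r′ c 0<k (s≤s k≤)))
  ... | no _ | yes (divides c refl) = ∈-++⁺ʳ units (∈-++⁺ʳ (map (p ℕ.*_) (1… r′))
    (multiple r p′ c 0<k (subst (k ℕ.<_) (ℕₚ.*-comm p r) (s≤s k≤))))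
  ... | no p∤k | no r∤k = ∈-++⁺ˡ (∈-filter⁺ (λ k → coprime? k (p ℕ.* r)) (∈-1…⁺ 0<k (ℕₚ.m≤n⇒m≤1+n k≤)) coprime)
    where
    coprime : Coprime k (p ℕ.* r)
    coprime (d∣k , d∣pr) with divisors-pr p-prime r-prime d∣pr
    ... | inj₁ d≡1 = d≡1
    ... | inj₂ (inj₁ refl) = contradiction d∣k p∤k
    ... | inj₂ (inj₂ (inj₁ refl)) = contradiction d∣k r∤k
    ... | inj₂ (inj₂ (inj₂ refl)) = contradiction (∣-trans (m∣m*n r) d∣k) p∤k

-- The cyclotomic polynomials Φ_1, Φ_p and Φ_pr

lastEntry : List (ℕ × Poly) → Poly
lastEntry [] = 1ₚ
lastEntry (e ∷ []) = proj₂ e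
lastEntry (_ ∷ e ∷ es) = lastEntry (e ∷ es)

lastEntry-unique : (f : List (ℕ × Poly) → Poly) → f [] ≡ 1ₚ → (∀ e → f (e ∷ []) ≡ proj₂ e) →
  (∀ d e es → f (d ∷ e ∷ es) ≡ f (e ∷ es)) → ∀ es → f es ≡ lastEntry es
lastEntry-unique f f₁ f₂ f₃ [] = f₁
lastEntry-unique f f₁ f₂ f₃ (e ∷ []) = f₂ e
lastEntry-unique f f₁ f₂ f₃ (d ∷ e ∷ es) = trans (f₃ d e es) (lastEntry-unique f f₁ f₂ f₃ (e ∷ es))

-- `lastPoly` is private as well and is recovered by unification, like the division steps.
mutual
  Defs-lastPoly : List (ℕ × Poly) → Poly
  Defs-lastPoly = _

  Φ-lastEntry : ∀ n → Φ n ≡ lastEntry (cycloTable n)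
  Φ-lastEntry n with cycloTable n
  ... | es = lastEntry-unique Defs-lastPoly refl (λ _ → refl) (λ _ _ _ → refl) es

lastEntry-∷ʳ : ∀ es e → lastEntry (es ++ [ e ]) ≡ proj₂ e
lastEntry-∷ʳ [] e = refl
lastEntry-∷ʳ (d ∷ []) e = refl
lastEntry-∷ʳ (_ ∷ d ∷ es) e = lastEntry-∷ʳ (d ∷ es) e

-- For `k` equal to m - 1 this is the divisor in the recursion for `Φ m`. Keeping `k` apart from `m`
-- allows induction along the table.
divisorProduct : ℕ → ℕ → Poly
divisorProduct k m = prodₚ (map proj₂ (filter (λ e → proj₁ e ∣? m) (cycloTable k)))

Φ-suc : ∀ n → Φ (suc n) ≡ quotₚ (X^ (suc n) -ₚ 1ₚ) (divisorProduct n (suc n))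
Φ-suc n = trans (Φ-lastEntry (suc n)) (lastEntry-∷ʳ (cycloTable n) _)

cycloTable-suc : ∀ n → cycloTable (suc n) ≡ cycloTable n ++ [ (suc n , Φ (suc n)) ]
cycloTable-suc n = cong (λ P → cycloTable n ++ [ (suc n , P) ]) (sym (Φ-suc n))

prodₚ-++ : ∀ Ps Qs → prodₚ (Ps ++ Qs) ≋ prodₚ Ps *ₚ prodₚ Qs
prodₚ-++ [] Qs = ≋-sym (*ₚ-identityˡ (prodₚ Qs))
prodₚ-++ (P ∷ Ps) Qs = ≋-trans (*ₚ-congʳ P (prodₚ-++ Ps Qs)) (≋-sym (*ₚ-assoc P (prodₚ Ps) (prodₚ Qs)))

filter-cycloTable : ∀ k m → filter (λ e → proj₁ e ∣? m) (cycloTable (suc k)) ≡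
  filter (λ e → proj₁ e ∣? m) (cycloTable k) ++ filter (λ e → proj₁ e ∣? m) [ (suc k , Φ (suc k)) ]
filter-cycloTable k m = trans (cong (filter (λ e → proj₁ e ∣? m)) (cycloTable-suc k))
  (Listₚ.filter-++ (λ e → proj₁ e ∣? m) (cycloTable k) _)

divisorProduct-∣ : ∀ k m → suc k ∣ m → divisorProduct (suc k) m ≋ divisorProduct k m *ₚ Φ (suc k)
divisorProduct-∣ k m k∣m = begin
  divisorProduct (suc k) m
    ≡⟨ cong (prodₚ ∘ map proj₂) (trans (filter-cycloTable k m) (cong (divisors ++_) (Listₚ.filter-accept (λ e → proj₁ e ∣? m) k∣m))) ⟩
  prodₚ (map proj₂ (divisors ++ [ (suc k , Φ (suc k)) ]))
    ≡⟨ cong prodₚ (Listₚ.map-++ proj₂ divisors _) ⟩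
  prodₚ (map proj₂ divisors ++ [ Φ (suc k) ])
    ≈⟨ prodₚ-++ (map proj₂ divisors) [ Φ (suc k) ] ⟩
  divisorProduct k m *ₚ (Φ (suc k) *ₚ 1ₚ)
    ≈⟨ *ₚ-congʳ (divisorProduct k m) (*ₚ-identityʳ (Φ (suc k))) ⟩
  divisorProduct k m *ₚ Φ (suc k) ∎
  where
  open ≋-Reasoning
  divisors = filter (λ e → proj₁ e ∣? m) (cycloTable k)

divisorProduct-∤ : ∀ k m → ¬ suc k ∣ m → divisorProduct (suc k) m ≡ divisorProduct k m
divisorProduct-∤ k m k∤m = cong (prodₚ ∘ map proj₂) (trans (filter-cycloTable k m)
  (trans (cong (divisors ++_) (Listₚ.filter-reject (λ e → proj₁ e ∣? m) k∤m)) (Listₚ.++-identityʳ divisors)))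
  where divisors = filter (λ e → proj₁ e ∣? m) (cycloTable k)

divisorProduct-skip : ∀ m k l → k ℕ.≤ l → (∀ j → k ℕ.< j → j ℕ.≤ l → ¬ j ∣ m) →
  divisorProduct l m ≡ divisorProduct k m
divisorProduct-skip m zero zero _ _ = refl
divisorProduct-skip m k (suc l) k≤l none with ℕₚ.m≤n⇒m<n∨m≡n k≤l
... | inj₂ refl = refl
... | inj₁ (s≤s k≤l) = trans (divisorProduct-∤ l m (none (suc l) (s≤s k≤l) ℕₚ.≤-refl))
  (divisorProduct-skip m k l k≤l λ j k<j j≤l → none j k<j (ℕₚ.m≤n⇒m≤1+n j≤l))

divisorProduct-prime : ∀ {p′} → Prime (suc p′) → divisorProduct p′ (suc p′) ≋ Φ 1
divisorProduct-prime {p′} p-prime = begin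
  divisorProduct p′ p            ≡⟨ divisorProduct-skip p 1 p′ (ℕ.s≤s⁻¹ (prime⇒1< p-prime)) none ⟩
  divisorProduct 1 p             ≈⟨ divisorProduct-∣ 0 p (1∣ p) ⟩
  1ₚ *ₚ Φ 1                      ≈⟨ *ₚ-identityˡ (Φ 1) ⟩
  Φ 1                            ∎
  where
  open ≋-Reasoning
  p = suc p′
  none : ∀ j → 1 ℕ.< j → j ℕ.≤ p′ → ¬ j ∣ p
  none j 1<j j≤p′ j∣p with prime⇒irreducible p-prime j∣p
  ... | inj₁ refl = ℕₚ.<-irrefl refl 1<j
  ... | inj₂ refl = ℕₚ.<-irrefl refl j≤p′

-- The growing table meets the proper divisors in the order 1, p, r and none in between; the order
-- of p and r has to be fixed for this.
divisorProduct-pr-< : ∀ {p r} → Prime p → Prime r → p ℕ.< r →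
  divisorProduct (ℕ.pred (p ℕ.* r)) (p ℕ.* r) ≋ Φ 1 *ₚ (Φ p *ₚ Φ r)
divisorProduct-pr-< {zero} p-prime r-prime p<r = contradiction (prime⇒1< p-prime) λ ()
divisorProduct-pr-< {p@(suc p′)} {r@(suc r′)} p-prime r-prime p<r = begin
  divisorProduct (ℕ.pred pr) pr
    ≡⟨ divisorProduct-skip pr r _ r≤pr-1 (λ j r<j j≤ → none (ℕₚ.<-trans 1<r r<j) (ℕₚ.>⇒≢ (ℕₚ.<-trans p<r r<j)) (ℕₚ.>⇒≢ r<j) (ℕₚ.<⇒≢ (s≤s j≤))) ⟩
  divisorProduct r pr
    ≈⟨ divisorProduct-∣ r′ pr (n∣m*n p) ⟩
  divisorProduct r′ pr *ₚ Φ r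
    ≡⟨ cong (_*ₚ Φ r) (divisorProduct-skip pr p r′ (ℕ.s≤s⁻¹ p<r) λ j p<j j≤r′ → none (ℕₚ.<-trans 1<p p<j) (ℕₚ.>⇒≢ p<j) (ℕₚ.<⇒≢ (s≤s j≤r′)) (ℕₚ.<⇒≢ (ℕₚ.≤-trans (s≤s j≤r′) (ℕₚ.m≤n*m r p)))) ⟩
  divisorProduct p pr *ₚ Φ r
    ≈⟨ *ₚ-cong (divisorProduct-∣ p′ pr (m∣m*n r)) ≋-refl ⟩
  (divisorProduct p′ pr *ₚ Φ p) *ₚ Φ r
    ≡⟨ cong (λ P → (P *ₚ Φ p) *ₚ Φ r) (divisorProduct-skip pr 1 p′ (ℕ.s≤s⁻¹ 1<p) λ j 1<j j≤p′ → none 1<j (ℕₚ.<⇒≢ (s≤s j≤p′)) (ℕₚ.<⇒≢ (ℕₚ.<-trans (s≤s j≤p′) p<r)) (ℕₚ.<⇒≢ (ℕₚ.≤-trans (s≤s j≤p′) (ℕₚ.m≤m*n p r)))) ⟩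
  (divisorProduct 1 pr *ₚ Φ p) *ₚ Φ r
    ≈⟨ *ₚ-cong (*ₚ-cong (divisorProduct-∣ 0 pr (1∣ pr)) ≋-refl) ≋-refl ⟩
  ((1ₚ *ₚ Φ 1) *ₚ Φ p) *ₚ Φ r
    ≈⟨ rearrange (Φ 1) (Φ p) (Φ r) ⟩
  Φ 1 *ₚ (Φ p *ₚ Φ r) ∎
  where
  open ≋-Reasoning
  pr = p ℕ.* r
  1<p = prime⇒1< p-prime
  1<r = prime⇒1< r-prime
  r≤pr-1 : r ℕ.≤ ℕ.pred pr
  r≤pr-1 = ℕ.s≤s⁻¹ (subst (r ℕ.<_) (ℕₚ.*-comm r p) (ℕₚ.m<m*n r p 1<p))
  none : ∀ {j} → 1 ℕ.< j → j ≢ p → j ≢ r → j ≢ pr → ¬ j ∣ pr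
  none 1<j j≢p j≢r j≢pr j∣pr with divisors-pr p-prime r-prime j∣pr
  ... | inj₁ refl = ℕₚ.<-irrefl refl 1<j
  ... | inj₂ (inj₁ j≡p) = j≢p j≡p
  ... | inj₂ (inj₂ (inj₁ j≡r)) = j≢r j≡r
  ... | inj₂ (inj₂ (inj₂ j≡pr)) = j≢pr j≡pr
  rearrange : ∀ A B C → ((1ₚ *ₚ A) *ₚ B) *ₚ C ≋ A *ₚ (B *ₚ C)
  rearrange = solve-∀ poly-ring

divisorProduct-pr : ∀ {p r} → Prime p → Prime r → p ≢ r →
  divisorProduct (ℕ.pred (p ℕ.* r)) (p ℕ.* r) ≋ Φ 1 *ₚ (Φ p *ₚ Φ r)
divisorProduct-pr {p} {r} p-prime r-prime p≢r with ℕₚ.<-cmp p r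
... | tri< p<r _ _ = divisorProduct-pr-< p-prime r-prime p<r
... | tri≈ _ p≡r _ = contradiction p≡r p≢r
... | tri> _ _ r<p = ≋-trans
  (subst (λ n → divisorProduct (ℕ.pred n) n ≋ Φ 1 *ₚ (Φ r *ₚ Φ p)) (ℕₚ.*-comm r p) (divisorProduct-pr-< r-prime p-prime r<p))
  (*ₚ-congʳ (Φ 1) (*ₚ-comm (Φ r) (Φ p)))

Φ1≋ : Φ 1 ≋ X -ₚ 1ₚ
Φ1≋ = ≋-refl

DegLt-const : ∀ c n → DegLt (constₚ c) (suc n)
DegLt-const c n zero ()
DegLt-const c n (suc i) _ = refl

DegLt-X^-1 : ∀ n → DegLt (X^ n -ₚ 1ₚ) (suc n)
DegLt-X^-1 n = DegLt-+ {X^ n} (DegLt-X^ n) (DegLt-neg {1ₚ} (DegLt-const 1ℚ n))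

coeff-X^-1 : ∀ n .{{_ : NonZero n}} → coeff (X^ n -ₚ 1ₚ) n ≡ 1ℚ
coeff-X^-1 n@(suc _) = trans (coeff-- (X^ n) 1ₚ n) (cong (ℚ._- 0ℚ) (coeff-X^ n))

Φ-prime : ∀ {p} → Prime p → Φ p ≋ ones p
Φ-prime {zero} p-prime = contradiction (prime⇒1< p-prime) λ ()
Φ-prime {p@(suc p′)} p-prime = ≋-trans (by-coeff λ i → cong (λ P → coeff P i) (Φ-suc p′))
  (quotₚ-* (X^ p -ₚ 1ₚ) (divisorProduct p′ p) (ones p) 1 p′
    (at D≋ 1) (DegLt-resp (≋-sym D≋) (DegLt-X^-1 1))
    (λ e → 1≢0 (trans (sym (coeff-X^-1 p)) e)) (DegLt-ones p)
    (≋-trans (*ₚ-cong D≋ ≋-refl) (ones-telescope p)))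
  where
  D≋ : divisorProduct p′ p ≋ X -ₚ 1ₚ
  D≋ = divisorProduct-prime p-prime

module Ones-remainder {n a : ℕ} .{{_ : NonZero n}} (1<n : 1 ℕ.< n) (coprime : Coprime n a) where
  open Fold n a
  open Unit 1<n coprime

  -- Multiplication by a unit permutes the residues, so each exponent below `n` occurs exactly once.
  remainder≋ones : remainder n ≋ ones n
  remainder≋ones = by-coeff λ i → Indicator-unique
    (remainder-indicator residue-injective n ℕₚ.≤-refl i)
    (Indicator-map (residue-surjective i) (λ { (j , _ , e) → subst (ℕ._< n) (sym e) (ℕ.m%n<n (j ℕ.* a) n) }) (ones-indicator n i))

module Φpr {p r : ℕ} (p-prime : Prime p) (r-prime : Prime r) (p≢r : p ≢ r) where
  private instance
    p≢0 = prime⇒nonZero p-prime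
    r≢0 = prime⇒nonZero r-prime

  1<p = prime⇒1< p-prime
  coprime-pr : Coprime p r
  coprime-pr = ∤⇒coprime p-prime (distinct-primes-∤ p-prime r-prime p≢r)

  open Fold p r using (geo-fold; remainder; quotient; quotient-indicator)
  open Unit 1<p coprime-pr using (residue-injective)

  -- The i with coefficient 1 in gaps are the natural numbers that are not of the form x p + y r:
  -- in the residue class of j r modulo p (j < p), these are the numbers below j r.
  gaps : Poly
  gaps = quotient p

  Gap : ℕ → Set
  Gap i = Below p (λ j → i ℕ.< j ℕ.* r × i ℕ.% p ≡ (j ℕ.* r) ℕ.% p)

  gaps-indicator : ∀ i → Indicator (Gap i) (coeff gaps i)
  gaps-indicator = quotient-indicator residue-injective p ℕₚ.≤-refl

  φ′ : ℕ
  φ′ = ℕ.pred p ℕ.* ℕ.pred r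

  -- The Frobenius number of p and r is φ′ - 1. For a gap i below j r, the difference j r - i is a
  -- positive multiple of p; but if i is at least φ′, it is at most (p - 1) r - (p - 1)(r - 1) = p -
  -- 1.
  DegLt-gaps : DegLt gaps φ′
  DegLt-gaps i φ′≤i = Indicator-0 not-gap (gaps-indicator i)
    where
    open ℕₚ.≤-Reasoning
    not-gap : ¬ Gap i
    not-gap (j , j<p , i<jr , e) = ℕₚ.<⇒≱ jr∸i<p
      (∣⇒≤ {{ℕ.>-nonZero (ℕₚ.m<n⇒0<n∸m i<jr)}} (%≡%⇒∣∸ i (j ℕ.* r) p e))
      where
      jr∸i<p : j ℕ.* r ∸ i ℕ.< p
      jr∸i<p = begin-strict
        j ℕ.* r ∸ i                                            ≤⟨ ℕₚ.∸-mono (ℕₚ.*-monoˡ-≤ r (ℕₚ.<⇒≤pred j<p)) φ′≤i ⟩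
        ℕ.pred p ℕ.* r ∸ φ′                                    ≡⟨ cong (λ x → ℕ.pred p ℕ.* x ∸ φ′) (sym (ℕₚ.suc-pred r)) ⟩
        ℕ.pred p ℕ.* suc (ℕ.pred r) ∸ φ′                       ≡⟨ cong (_∸ φ′) (ℕₚ.*-suc (ℕ.pred p) (ℕ.pred r)) ⟩
        (ℕ.pred p ℕ.+ φ′) ∸ φ′                                 ≡⟨ ℕₚ.m+n∸n≡m (ℕ.pred p) φ′ ⟩
        ℕ.pred p                                               <⟨ ℕₚ.≤-reflexive (ℕₚ.suc-pred p) ⟩
        p                                                      ∎

  Ψ : Poly
  Ψ = 1ₚ +ₚ (X -ₚ 1ₚ) *ₚ gaps

  DegLt-Ψ : DegLt Ψ (suc φ′)
  DegLt-Ψ = DegLt-+ {1ₚ} {(X -ₚ 1ₚ) *ₚ gaps} (DegLt-const 1ℚ φ′) (DegLt-* {X -ₚ 1ₚ} {gaps} 1 (DegLt-X^-1 1) DegLt-gaps)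

  ones-Ψ : ones p *ₚ Ψ ≋ geo r p
  ones-Ψ = begin
    ones p *ₚ (1ₚ +ₚ (X -ₚ 1ₚ) *ₚ gaps)              ≈⟨ rearrange (ones p) (X -ₚ 1ₚ) gaps ⟩
    ones p +ₚ ((X -ₚ 1ₚ) *ₚ ones p) *ₚ gaps          ≈⟨ +ₚ-cong (≋-sym (Ones-remainder.remainder≋ones 1<p coprime-pr)) (*ₚ-cong (ones-telescope p) ≋-refl) ⟩
    remainder p +ₚ (X^ p -ₚ 1ₚ) *ₚ gaps              ≈⟨ geo-fold p ⟨
    geo r p                                          ∎
    where
    open ≋-Reasoning
    rearrange : ∀ A M G → A *ₚ (1ₚ +ₚ M *ₚ G) ≋ A +ₚ (M *ₚ A) *ₚ G
    rearrange = solve-∀ poly-ring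

  divisors-Ψ : ((X^ r -ₚ 1ₚ) *ₚ ones p) *ₚ Ψ ≋ X^ (p ℕ.* r) -ₚ 1ₚ
  divisors-Ψ = begin
    ((X^ r -ₚ 1ₚ) *ₚ ones p) *ₚ Ψ          ≈⟨ *ₚ-assoc (X^ r -ₚ 1ₚ) (ones p) Ψ ⟩
    (X^ r -ₚ 1ₚ) *ₚ (ones p *ₚ Ψ)          ≈⟨ *ₚ-congʳ (X^ r -ₚ 1ₚ) ones-Ψ ⟩
    (X^ r -ₚ 1ₚ) *ₚ geo r p                ≈⟨ geo-telescope r p ⟩
    X^ (r ℕ.* p) -ₚ 1ₚ                     ≡⟨ cong (λ n → X^ n -ₚ 1ₚ) (ℕₚ.*-comm r p) ⟩
    X^ (p ℕ.* r) -ₚ 1ₚ                     ∎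
    where open ≋-Reasoning

  -- The product over the proper divisors of pr becomes `(X^ r -ₚ 1ₚ) *ₚ ones p`, monic of degree r
  -- + p - 1, and `divisors-Ψ` is then the factorisation that `quotₚ-*` asks for.
  Φpr≋Ψ : Φ (p ℕ.* r) ≋ Ψ
  Φpr≋Ψ = subst (λ n → Φ n ≋ Ψ) (ℕₚ.suc-pred (p ℕ.* r) {{ℕₚ.m*n≢0 p r}})
    (≋-trans (by-coeff λ i → cong (λ P → coeff P i) (Φ-suc (ℕ.pred pr)))
      (quotₚ-* (X^ (suc (ℕ.pred pr)) -ₚ 1ₚ) D Ψ (r ℕ.+ ℕ.pred p) φ′ monic D-deg top DegLt-Ψ
        (≋-trans (*ₚ-cong D≋ ≋-refl) (subst (λ n → ((X^ r -ₚ 1ₚ) *ₚ ones p) *ₚ Ψ ≋ X^ n -ₚ 1ₚ) (sym pr≡) divisors-Ψ))))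
    where
    open ≋-Reasoning
    pr = p ℕ.* r
    pr≡ : suc (ℕ.pred pr) ≡ pr
    pr≡ = ℕₚ.suc-pred pr {{ℕₚ.m*n≢0 p r}}
    D = divisorProduct (ℕ.pred pr) (suc (ℕ.pred pr))
    rearrange : ∀ A B C → A *ₚ (B *ₚ C) ≋ (A *ₚ C) *ₚ B
    rearrange = solve-∀ poly-ring
    D≋ : D ≋ (X^ r -ₚ 1ₚ) *ₚ ones p
    D≋ = begin
      D                                       ≡⟨ cong (divisorProduct (ℕ.pred pr)) pr≡ ⟩
      divisorProduct (ℕ.pred pr) pr           ≈⟨ divisorProduct-pr p-prime r-prime p≢r ⟩
      Φ 1 *ₚ (Φ p *ₚ Φ r)                     ≈⟨ *ₚ-congʳ (Φ 1) (*ₚ-cong (Φ-prime p-prime) (Φ-prime r-prime)) ⟩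
      (X -ₚ 1ₚ) *ₚ (ones p *ₚ ones r)         ≈⟨ rearrange (X -ₚ 1ₚ) (ones p) (ones r) ⟩
      ((X -ₚ 1ₚ) *ₚ ones r) *ₚ ones p         ≈⟨ *ₚ-cong (ones-telescope r) ≋-refl ⟩
      (X^ r -ₚ 1ₚ) *ₚ ones p                  ∎
    p≡ : suc (ℕ.pred p) ≡ p
    p≡ = ℕₚ.suc-pred p
    D-deg : DegLt D (suc (r ℕ.+ ℕ.pred p))
    D-deg = DegLt-resp (≋-sym D≋) (subst (DegLt ((X^ r -ₚ 1ₚ) *ₚ ones p)) (trans (cong (r ℕ.+_) (sym p≡)) (ℕₚ.+-suc r (ℕ.pred p)))
      (DegLt-* {X^ r -ₚ 1ₚ} r (DegLt-X^-1 r) (DegLt-ones p)))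
    monic : coeff D (r ℕ.+ ℕ.pred p) ≡ 1ℚ
    monic = trans (at D≋ (r ℕ.+ ℕ.pred p)) (trans
      (*ₚ-coeff-top (X^ r -ₚ 1ₚ) r (coeff-X^-1 r) (DegLt-X^-1 r) (ℕ.pred p) (ones p) (subst (DegLt (ones p)) (sym p≡) (DegLt-ones p)))
      (Indicator-1 (ℕₚ.≤-reflexive p≡) (ones-indicator p (ℕ.pred p))))
    degree : r ℕ.+ ℕ.pred p ℕ.+ φ′ ≡ suc (ℕ.pred pr)
    degree = sym (trans pr≡ (trans (trans (cong (ℕ._* r) (sym p≡)) (cong (r ℕ.+_) (trans (cong (ℕ.pred p ℕ.*_) (sym (ℕₚ.suc-pred r))) (ℕₚ.*-suc (ℕ.pred p) (ℕ.pred r))))) (sym (ℕₚ.+-assoc r (ℕ.pred p) φ′))))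
    top : coeff (X^ (suc (ℕ.pred pr)) -ₚ 1ₚ) (r ℕ.+ ℕ.pred p ℕ.+ φ′) ≢ 0ℚ
    top e = 1≢0 (trans (sym (trans (cong (coeff (X^ (suc (ℕ.pred pr)) -ₚ 1ₚ)) degree) (coeff-X^-1 (suc (ℕ.pred pr))))) e)

-- Integer coefficients bounded above

infix 4 _≲_
-- Integrality and the upper bound travel together: both are additive, and the goal wants them of
-- one witness.
_≲_ : ℚ → ℤ → Set
x ≲ b = ∃ λ v → x ≡ ℤ→ℚ v × v ℤ.≤ b

≲-resp : ∀ {x y b} → x ≡ y → y ≲ b → x ≲ b
≲-resp refl h = h

≲-trans : ∀ {x b c} → x ≲ b → b ℤ.≤ c → x ≲ c
≲-trans (v , e , v≤b) b≤c = v , e , ℤₚ.≤-trans v≤b b≤c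

≲-+ : ∀ {x y b c} → x ≲ b → y ≲ c → x ℚ.+ y ≲ b ℤ.+ c
≲-+ (v , refl , v≤b) (w , refl , w≤c) = v ℤ.+ w , sym (ℤ→ℚ-+ v w) , ℤₚ.+-mono-≤ v≤b w≤c

ℕ→ℚ-≲ : ∀ {m n} → m ℕ.≤ n → ℕ→ℚ m ≲ + n
ℕ→ℚ-≲ {m} m≤n = + m , refl , ℤ.+≤+ m≤n

-ℕ→ℚ-≲ : ∀ m → ℚ.- ℕ→ℚ m ≲ + 0
-ℕ→ℚ-≲ m = ℤ.- + m , sym (ℤ→ℚ-neg (+ m)) , ℤₚ.neg-≤-pos {m} {0}

Indicator-≲ : ∀ {P x} → Indicator P x → x ≲ + 1
Indicator-≲ (inj₁ (_ , refl)) = ℕ→ℚ-≲ {1} ℕₚ.≤-refl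
Indicator-≲ (inj₂ (_ , refl)) = ℕ→ℚ-≲ {0} z≤n

-Indicator-≲ : ∀ {P x} → Indicator P x → ℚ.- x ≲ + 0
-Indicator-≲ (inj₁ (_ , refl)) = -ℕ→ℚ-≲ 1
-Indicator-≲ (inj₂ (_ , refl)) = -ℕ→ℚ-≲ 0

-- The product is a sum of `q` shifted copies of `A`, so only the coefficients of `A` at i - s - p j
-- enter. A copy that starts above `i` contributes 0, at most `b` because `b` is natural.
coeff-*-geo-≲ : ∀ A s p q b i → (∀ j m → j ℕ.< q → i ≡ s ℕ.+ p ℕ.* j ℕ.+ m → coeff A m ≲ + b) →
  coeff (A *ₚ (X^ s *ₚ geo p q)) i ≲ + (q ℕ.* b)
coeff-*-geo-≲ A s p zero b i bound = ≲-resp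
  (at (≋-trans (*ₚ-congʳ A (*ₚ-zeroʳ (X^ s))) (*ₚ-zeroʳ A)) i) (ℕ→ℚ-≲ {0} z≤n)
coeff-*-geo-≲ A s p (suc q) b i bound = ≲-resp (trans (at split i) (coeff-+ (A *ₚ (X^ s *ₚ geo p q)) _ i))
  (≲-trans (≲-+ (coeff-*-geo-≲ A s p q b i (λ j m j<q → bound j m (ℕₚ.m<n⇒m<1+n j<q))) last)
    (ℤₚ.≤-reflexive (cong +_ (ℕₚ.+-comm (q ℕ.* b) b))))
  where
  rearrange : ∀ A S G Y → A *ₚ (S *ₚ (G +ₚ Y)) ≋ A *ₚ (S *ₚ G) +ₚ (S *ₚ Y) *ₚ A
  rearrange = solve-∀ poly-ring
  split : A *ₚ (X^ s *ₚ geo p (suc q)) ≋ A *ₚ (X^ s *ₚ geo p q) +ₚ X^ (s ℕ.+ p ℕ.* q) *ₚ A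
  split = ≋-trans (rearrange A (X^ s) (geo p q) (X^ (p ℕ.* q)))
    (+ₚ-cong {A *ₚ (X^ s *ₚ geo p q)} ≋-refl (*ₚ-cong (X^-+ s (p ℕ.* q)) ≋-refl))
  last : coeff (X^ (s ℕ.+ p ℕ.* q) *ₚ A) i ≲ + b
  last with s ℕ.+ p ℕ.* q ℕ.≤? i
  ... | yes s≤i = ≲-resp (X^*-coeff-≥ (s ℕ.+ p ℕ.* q) A i s≤i)
    (bound q (i ∸ (s ℕ.+ p ℕ.* q)) ℕₚ.≤-refl (sym (ℕₚ.m+[n∸m]≡n s≤i)))
  ... | no s≰i = ≲-resp (X^*-coeff-< (s ℕ.+ p ℕ.* q) A i (ℕₚ.≰⇒> s≰i)) (ℕ→ℚ-≲ {0} z≤n)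

-- Quotients of ones and geo

constₚ-cong : ∀ {a b} → a ≡ b → constₚ a ≋ constₚ b
constₚ-cong refl = ≋-refl

constₚ-suc : ∀ n → constₚ (ℕ→ℚ (suc n)) ≋ 1ₚ +ₚ constₚ (ℕ→ℚ n)
constₚ-suc n = constₚ-cong (ℕ→ℚ-suc n)

constₚ-recip : ∀ n .{{_ : NonZero n}} → constₚ (recipℕ n) *ₚ constₚ (ℕ→ℚ n) ≋ 1ₚ
constₚ-recip n = ≋-trans (*ₚ-constʳ (constₚ (recipℕ n)) (ℕ→ℚ n))
  (constₚ-cong (trans (ℚₚ.*-comm (ℕ→ℚ n) (recipℕ n)) (recip-* n)))

staircase : ℕ → Poly
staircase n = map (λ k → ℕ→ℚ (n ∸ k)) (upTo n)

staircase-suc : ∀ n → staircase (suc n) ≡ ℕ→ℚ (suc n) ∷ staircase n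
staircase-suc n = trans (Listₚ.map-upTo (λ k → ℕ→ℚ (suc n ∸ k)) (suc n))
  (cong (ℕ→ℚ (suc n) ∷_) (sym (Listₚ.map-upTo (λ k → ℕ→ℚ (n ∸ k)) n)))

-- Each X^j - 1 is X - 1 times 1 + X + ⋯ + X^(j-1). Summed over j up to n, the power X^k is counted
-- once for each j > k, that is n - k times.
ones-staircase : ∀ n → (X -ₚ 1ₚ) *ₚ staircase n ≋ ones (suc n) -ₚ constₚ (ℕ→ℚ (suc n))
ones-staircase zero = ≋-trans (*ₚ-zeroʳ (X -ₚ 1ₚ)) (≋-sym (-ₚ-inverseʳ 1ₚ))
ones-staircase (suc n) = begin
  (X -ₚ 1ₚ) *ₚ staircase (suc n)
    ≡⟨ cong ((X -ₚ 1ₚ) *ₚ_) (staircase-suc n) ⟩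
  (X -ₚ 1ₚ) *ₚ (ℕ→ℚ (suc n) ∷ staircase n)
    ≈⟨ *ₚ-congʳ (X -ₚ 1ₚ) (∷-X (ℕ→ℚ (suc n)) (staircase n)) ⟩
  (X -ₚ 1ₚ) *ₚ (c +ₚ X *ₚ staircase n)
    ≈⟨ rearrange X c (staircase n) ⟩
  X *ₚ ((X -ₚ 1ₚ) *ₚ staircase n) +ₚ (X -ₚ 1ₚ) *ₚ c
    ≈⟨ +ₚ-cong (*ₚ-congʳ X (ones-staircase n)) ≋-refl ⟩
  X *ₚ (ones (suc n) -ₚ c) +ₚ (X -ₚ 1ₚ) *ₚ c
    ≈⟨ rearrange′ X (ones (suc n)) c ⟩
  (1ₚ +ₚ X *ₚ ones (suc n)) -ₚ (1ₚ +ₚ c)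
    ≈⟨ +ₚ-cong (∷-X 1ℚ (ones (suc n))) (-ₚ-cong (constₚ-suc (suc n))) ⟨
  ones (suc (suc n)) -ₚ constₚ (ℕ→ℚ (suc (suc n))) ∎
  where
  open ≋-Reasoning
  c = constₚ (ℕ→ℚ (suc n))
  rearrange : ∀ X C S → (X -ₚ 1ₚ) *ₚ (C +ₚ X *ₚ S) ≋ X *ₚ ((X -ₚ 1ₚ) *ₚ S) +ₚ (X -ₚ 1ₚ) *ₚ C
  rearrange = solve-∀ poly-ring
  rearrange′ : ∀ X O C → X *ₚ (O -ₚ C) +ₚ (X -ₚ 1ₚ) *ₚ C ≋ (1ₚ +ₚ X *ₚ O) -ₚ (1ₚ +ₚ C)
  rearrange′ = solve-∀ poly-ring

-- Each X^(a j) is 1 plus X^a - 1 times `geo a j`: the ones add up to the constant, the cofactors to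
-- the sum on the right.
geo-stack : ∀ a n → geo a n ≋ constₚ (ℕ→ℚ n) +ₚ (X^ a -ₚ 1ₚ) *ₚ sumₚ (geo a) n
geo-stack a zero = ≋-trans (by-coeff λ { zero → refl ; (suc i) → refl })
  (+ₚ-cong {constₚ 0ℚ} ≋-refl (≋-sym (*ₚ-zeroʳ (X^ a -ₚ 1ₚ))))
geo-stack a (suc n) = begin
  geo a n +ₚ X^ (a ℕ.* n)
    ≈⟨ +ₚ-cong (geo-stack a n) (X^-geo a n) ⟩
  (c +ₚ M *ₚ sumₚ (geo a) n) +ₚ (1ₚ +ₚ M *ₚ geo a n)
    ≈⟨ rearrange c M (sumₚ (geo a) n) (geo a n) ⟩
  (1ₚ +ₚ c) +ₚ M *ₚ (sumₚ (geo a) n +ₚ geo a n)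
    ≈⟨ +ₚ-cong (constₚ-suc n) (≋-refl {M *ₚ sumₚ (geo a) (suc n)}) ⟨
  constₚ (ℕ→ℚ (suc n)) +ₚ M *ₚ sumₚ (geo a) (suc n) ∎
  where
  open ≋-Reasoning
  c = constₚ (ℕ→ℚ n)
  M = X^ a -ₚ 1ₚ
  rearrange : ∀ C M T G → (C +ₚ M *ₚ T) +ₚ (1ₚ +ₚ M *ₚ G) ≋ (1ₚ +ₚ C) +ₚ M *ₚ (T +ₚ G)
  rearrange = solve-∀ poly-ring

stack-coeff-∤ : ∀ a .{{_ : NonZero a}} n i → ¬ a ∣ i → coeff (sumₚ (geo a) n) i ≡ 0ℚ
stack-coeff-∤ a zero i a∤i = refl
stack-coeff-∤ a (suc n) i a∤i = trans (coeff-+ (sumₚ (geo a) n) (geo a n) i)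
  (cong₂ ℚ._+_ (stack-coeff-∤ a n i a∤i)
    (Indicator-0 (λ { (j , _ , refl) → a∤i (m∣m*n j) }) (geo-indicator a n i)))

-- X^(a k) occurs in `geo a j` exactly when k < j, hence for n - k of the j up to n, or for none if
-- k exceeds n.
stack-coeff-∣ : ∀ a .{{_ : NonZero a}} n k → coeff (sumₚ (geo a) (suc n)) (a ℕ.* k) ≡ ℕ→ℚ (n ∸ k)
stack-coeff-∣ a zero k = cong ℕ→ℚ (sym (ℕₚ.0∸n≡0 k))
stack-coeff-∣ a (suc n) k = trans (coeff-+ (sumₚ (geo a) (suc n)) (geo a (suc n)) (a ℕ.* k))
  (trans (cong (ℚ._+ coeff (geo a (suc n)) (a ℕ.* k)) (stack-coeff-∣ a n k)) (add (k ℕ.≤? n)))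
  where
  add : Dec (k ℕ.≤ n) → ℕ→ℚ (n ∸ k) ℚ.+ coeff (geo a (suc n)) (a ℕ.* k) ≡ ℕ→ℚ (suc n ∸ k)
  add (yes k≤n) = trans (cong (ℕ→ℚ (n ∸ k) ℚ.+_) (Indicator-1 (k , s≤s k≤n , refl) (geo-indicator a (suc n) (a ℕ.* k))))
    (trans (ℚₚ.+-comm (ℕ→ℚ (n ∸ k)) 1ℚ) (trans (sym (ℕ→ℚ-suc (n ∸ k))) (cong ℕ→ℚ (sym (ℕₚ.+-∸-assoc 1 k≤n)))))
  add (no k≰n) = trans (cong₂ ℚ._+_ (cong ℕ→ℚ (ℕₚ.m≤n⇒m∸n≡0 (ℕₚ.<⇒≤ (ℕₚ.≰⇒> k≰n))))
      (Indicator-0 (λ { (j , s≤s j≤n , e) → k≰n (subst (ℕ._≤ n) (sym (ℕₚ.*-cancelˡ-≡ k j a e)) j≤n) }) (geo-indicator a (suc n) (a ℕ.* k))))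
    (cong ℕ→ℚ (sym (ℕₚ.m≤n⇒m∸n≡0 (ℕₚ.≰⇒> k≰n))))

stack-coeff : ∀ a .{{_ : NonZero a}} n i → ∃ λ m → coeff (sumₚ (geo a) n) i ≡ ℕ→ℚ m
stack-coeff a zero i = 0 , refl
stack-coeff a (suc n) i with a ∣? i
... | no a∤i = 0 , stack-coeff-∤ a (suc n) i a∤i
... | yes (divides k refl) = n ∸ k , trans (cong (coeff (sumₚ (geo a) (suc n))) (ℕₚ.*-comm k a)) (stack-coeff-∣ a n k)

ones-geo : ∀ p n → ones p *ₚ geo p n ≋ ones (p ℕ.* n)
ones-geo p n = telescope-cancel 1 _ _ (begin
  (X -ₚ 1ₚ) *ₚ (ones p *ₚ geo p n)      ≈⟨ *ₚ-assoc (X -ₚ 1ₚ) (ones p) (geo p n) ⟨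
  ((X -ₚ 1ₚ) *ₚ ones p) *ₚ geo p n      ≈⟨ *ₚ-cong (ones-telescope p) ≋-refl ⟩
  (X^ p -ₚ 1ₚ) *ₚ geo p n               ≈⟨ geo-telescope p n ⟩
  X^ (p ℕ.* n) -ₚ 1ₚ                    ≈⟨ ones-telescope (p ℕ.* n) ⟨
  (X -ₚ 1ₚ) *ₚ ones (p ℕ.* n)           ∎)
  where open ≋-Reasoning

ones-+ : ∀ m n → ones (m ℕ.+ n) ≋ ones m +ₚ X^ m *ₚ ones n
ones-+ m n = telescope-cancel 1 _ _ (begin
  (X -ₚ 1ₚ) *ₚ ones (m ℕ.+ n)                                   ≈⟨ ones-telescope (m ℕ.+ n) ⟩
  X^ (m ℕ.+ n) -ₚ 1ₚ                                            ≈⟨ +ₚ-cong (X^-+ m n) ≋-refl ⟨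
  X^ m *ₚ X^ n -ₚ 1ₚ                                            ≈⟨ rearrange (X^ m) (X^ n) ⟩
  (X^ m -ₚ 1ₚ) +ₚ X^ m *ₚ (X^ n -ₚ 1ₚ)                          ≈⟨ +ₚ-cong (ones-telescope m) (*ₚ-congʳ (X^ m) (ones-telescope n)) ⟨
  (X -ₚ 1ₚ) *ₚ ones m +ₚ X^ m *ₚ ((X -ₚ 1ₚ) *ₚ ones n)          ≈⟨ rearrange′ (X -ₚ 1ₚ) (ones m) (X^ m) (ones n) ⟩
  (X -ₚ 1ₚ) *ₚ (ones m +ₚ X^ m *ₚ ones n)                       ∎)
  where
  open ≋-Reasoning
  rearrange : ∀ A B → A *ₚ B -ₚ 1ₚ ≋ (A -ₚ 1ₚ) +ₚ A *ₚ (B -ₚ 1ₚ)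
  rearrange = solve-∀ poly-ring
  rearrange′ : ∀ M A X B → M *ₚ A +ₚ X *ₚ (M *ₚ B) ≋ M *ₚ (A +ₚ X *ₚ B)
  rearrange′ = solve-∀ poly-ring

-- The source of every reduction modulo `ones p`: lengths that differ by a multiple of p give
-- congruent sums, with an explicit cofactor.
ones-+-* : ∀ m p n → ones (m ℕ.+ p ℕ.* n) ≋ ones m +ₚ ones p *ₚ (X^ m *ₚ geo p n)
ones-+-* m p n = begin
  ones (m ℕ.+ p ℕ.* n)                            ≈⟨ ones-+ m (p ℕ.* n) ⟩
  ones m +ₚ X^ m *ₚ ones (p ℕ.* n)                ≈⟨ +ₚ-cong {ones m} ≋-refl (*ₚ-congʳ (X^ m) (ones-geo p n)) ⟨
  ones m +ₚ X^ m *ₚ (ones p *ₚ geo p n)           ≈⟨ rearrange (ones m) (X^ m) (ones p) (geo p n) ⟩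
  ones m +ₚ ones p *ₚ (X^ m *ₚ geo p n)           ∎
  where
  open ≋-Reasoning
  rearrange : ∀ A B C D → A +ₚ B *ₚ (C *ₚ D) ≋ A +ₚ C *ₚ (B *ₚ D)
  rearrange = solve-∀ poly-ring

inverse-mod : ∀ {A A′ B B′} U V → A ≋ A′ → B ≋ B′ → A′ *ₚ U +ₚ B′ *ₚ V ≋ 1ₚ → InvCong A B U
inverse-mod U V A≋A′ B≋B′ e =
  V , at (≋-trans (+ₚ-cong (*ₚ-cong A≋A′ (≋-refl {U})) (*ₚ-cong B≋B′ (≋-refl {V}))) e)

scaled : ∀ c A B U V → A *ₚ U +ₚ B *ₚ V ≋ constₚ c → ∀ d → constₚ d *ₚ constₚ c ≋ 1ₚ →
  A *ₚ scaleₚ d U +ₚ B *ₚ scaleₚ d V ≋ 1ₚ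
scaled c A B U V e d dc≋1 = begin
  A *ₚ scaleₚ d U +ₚ B *ₚ scaleₚ d V              ≈⟨ +ₚ-cong (*ₚ-scaleʳ d A U) (*ₚ-scaleʳ d B V) ⟩
  scaleₚ d (A *ₚ U) +ₚ scaleₚ d (B *ₚ V)          ≈⟨ +ₚ-cong (*ₚ-constʳ (A *ₚ U) d) (*ₚ-constʳ (B *ₚ V) d) ⟨
  A *ₚ U *ₚ constₚ d +ₚ B *ₚ V *ₚ constₚ d        ≈⟨ *ₚ-distribʳ (constₚ d) (A *ₚ U) (B *ₚ V) ⟨
  (A *ₚ U +ₚ B *ₚ V) *ₚ constₚ d                  ≈⟨ *ₚ-cong e ≋-refl ⟩
  constₚ c *ₚ constₚ d                            ≈⟨ *ₚ-comm (constₚ c) (constₚ d) ⟩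
  constₚ d *ₚ constₚ c                            ≈⟨ dc≋1 ⟩
  1ₚ                                              ∎
  where open ≋-Reasoning

-- Inverses of cyclotomic polynomials

-- The cofactors of this one identity are the two inverses of (i).
Φ1-Φp-bezout : ∀ {p} .{{_ : NonZero p}} →
  (X -ₚ 1ₚ) *ₚ scaleₚ (ℚ.- recipℕ p) (staircase (p ∸ 1)) +ₚ ones p *ₚ constₚ (recipℕ p) ≋ 1ₚ
Φ1-Φp-bezout {p@(suc p′)} = begin
  (X -ₚ 1ₚ) *ₚ scaleₚ (ℚ.- recipℕ p) S +ₚ ones p *ₚ c    ≈⟨ +ₚ-cong (*ₚ-congʳ (X -ₚ 1ₚ) (*ₚ-constʳ S (ℚ.- recipℕ p))) ≋-refl ⟨
  (X -ₚ 1ₚ) *ₚ (S *ₚ (-ₚ c)) +ₚ ones p *ₚ c              ≈⟨ rearrange (X -ₚ 1ₚ) S c (ones p) ⟩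
  c *ₚ (ones p -ₚ (X -ₚ 1ₚ) *ₚ S)                        ≈⟨ *ₚ-congʳ c (+ₚ-cong {ones p} ≋-refl (-ₚ-cong (ones-staircase p′))) ⟩
  c *ₚ (ones p -ₚ (ones p -ₚ constₚ (ℕ→ℚ p)))            ≈⟨ rearrange′ c (ones p) (constₚ (ℕ→ℚ p)) ⟩
  c *ₚ constₚ (ℕ→ℚ p)                                    ≈⟨ constₚ-recip p ⟩
  1ₚ                                                     ∎
  where
  open ≋-Reasoning
  S = staircase p′
  c = constₚ (recipℕ p)
  rearrange : ∀ M S C O → M *ₚ (S *ₚ (-ₚ C)) +ₚ O *ₚ C ≋ C *ₚ (O -ₚ M *ₚ S)
  rearrange = solve-∀ poly-ring
  rearrange′ : ∀ C O P → C *ₚ (O -ₚ (O -ₚ P)) ≋ C *ₚ P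
  rearrange′ = solve-∀ poly-ring

Φp⁻¹-mod-Φ1 : ∀ {p} → Prime p → IsInvMod p 1 (constₚ (recipℕ p))
Φp⁻¹-mod-Φ1 {p} p-prime = DegLt-const (recipℕ p) 0 ,
  inverse-mod _ (scaleₚ (ℚ.- recipℕ p) (staircase (p ∸ 1))) (Φ-prime p-prime) Φ1≋
    (≋-trans (+ₚ-comm (ones p *ₚ constₚ (recipℕ p)) _) (Φ1-Φp-bezout {{prime⇒nonZero p-prime}}))

Φ1⁻¹-mod-Φp : ∀ {p} → Prime p → IsInvMod 1 p (scaleₚ (ℚ.- recipℕ p) (staircase (p ∸ 1)))
Φ1⁻¹-mod-Φp {p} p-prime =
  DegLt-scale (ℚ.- recipℕ p) {staircase (p ∸ 1)} (DegLt-weaken {staircase (p ∸ 1)} (φ-prime-≥ p-prime)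
    (subst (DegLt (staircase (p ∸ 1))) (trans (Listₚ.length-map _ (upTo (p ∸ 1))) (Listₚ.length-upTo (p ∸ 1))) (DegLt-length (staircase (p ∸ 1))))) ,
  inverse-mod _ (constₚ (recipℕ p)) Φ1≋ (Φ-prime p-prime) (Φ1-Φp-bezout {{prime⇒nonZero p-prime}})

-- The inverse of Φ_p modulo Φ_r

module Φp-mod-Φr {p r : ℕ} (p-prime : Prime p) (r-prime : Prime r) (p≢r : p ≢ r) where
  private instance
    r≢0 = prime⇒nonZero r-prime

  coprime-rp : Coprime r p
  coprime-rp = ∤⇒coprime r-prime (distinct-primes-∤ r-prime p-prime (p≢r ∘ sym))

  open Fold r p using (remainder; quotient; geo-fold; remainder-indicator)
  open Unit {r} {p} (prime⇒1< r-prime) coprime-rp using (inverse; residue-injective)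

  m = proj₁ inverse
  t = proj₁ (proj₂ (proj₂ inverse))

  remainder-m : ∀ i → Indicator (Below m (λ j → i ≡ (j ℕ.* p) ℕ.% r)) (coeff (remainder m) i)
  remainder-m = remainder-indicator residue-injective m (ℕₚ.<⇒≤ (proj₁ (proj₂ inverse)))

  c : ℚ
  c = coeff (remainder m) (r ∸ 1)

  U : Poly
  U = remainder m -ₚ scaleₚ c (ones r)

  -- Here m p = 1 + t r. The first term undoes the reduction of exponents modulo r, the second
  -- removes all of `ones (1 + r * t)` but its constant term, and the third makes up for the
  -- multiple of `ones r` subtracted in `U`.
  V : Poly
  V = (ones p *ₚ (X -ₚ 1ₚ) *ₚ quotient m -ₚ X *ₚ geo r t) +ₚ ones p *ₚ constₚ c

  bezout : ones p *ₚ U +ₚ ones r *ₚ V ≋ 1ₚ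
  bezout = begin
    ones p *ₚ (remainder m -ₚ scaleₚ c (ones r)) +ₚ ones r *ₚ V
      ≈⟨ +ₚ-cong (*ₚ-congʳ (ones p) (+ₚ-cong {remainder m} ≋-refl (-ₚ-cong (*ₚ-constʳ (ones r) c)))) ≋-refl ⟨
    ones p *ₚ (remainder m -ₚ ones r *ₚ constₚ c) +ₚ ones r *ₚ V
      ≈⟨ rearrange (ones p) (remainder m) (ones r) (constₚ c) (X -ₚ 1ₚ) (quotient m) (X *ₚ geo r t) ⟩
    ones p *ₚ (remainder m +ₚ ((X -ₚ 1ₚ) *ₚ ones r) *ₚ quotient m) -ₚ ones r *ₚ (X *ₚ geo r t)
      ≈⟨ +ₚ-cong (*ₚ-congʳ (ones p) (+ₚ-cong {remainder m} ≋-refl (*ₚ-cong (ones-telescope r) ≋-refl))) ≋-refl ⟩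
    ones p *ₚ (remainder m +ₚ (X^ r -ₚ 1ₚ) *ₚ quotient m) -ₚ ones r *ₚ (X *ₚ geo r t)
      ≈⟨ +ₚ-cong (*ₚ-congʳ (ones p) (geo-fold m)) ≋-refl ⟨
    ones p *ₚ geo p m -ₚ ones r *ₚ (X *ₚ geo r t)
      ≈⟨ +ₚ-cong (ones-geo p m) ≋-refl ⟩
    ones (p ℕ.* m) -ₚ ones r *ₚ (X *ₚ geo r t)
      ≡⟨ cong (λ n → ones n -ₚ ones r *ₚ (X *ₚ geo r t)) pm≡1+rt ⟩
    ones (1 ℕ.+ r ℕ.* t) -ₚ ones r *ₚ (X *ₚ geo r t)
      ≈⟨ +ₚ-cong (ones-+-* 1 r t) ≋-refl ⟩
    (1ₚ +ₚ ones r *ₚ (X *ₚ geo r t)) -ₚ ones r *ₚ (X *ₚ geo r t)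
      ≈⟨ cancel (ones r *ₚ (X *ₚ geo r t)) ⟩
    1ₚ ∎
    where
    open ≋-Reasoning
    pm≡1+rt : p ℕ.* m ≡ 1 ℕ.+ r ℕ.* t
    pm≡1+rt = trans (ℕₚ.*-comm p m) (trans (proj₂ (proj₂ (proj₂ inverse))) (cong suc (ℕₚ.*-comm t r)))
    rearrange : ∀ P R O C M Q G → P *ₚ (R -ₚ O *ₚ C) +ₚ O *ₚ ((P *ₚ M *ₚ Q -ₚ G) +ₚ P *ₚ C)
      ≋ P *ₚ (R +ₚ (M *ₚ O) *ₚ Q) -ₚ O *ₚ G
    rearrange = solve-∀ poly-ring
    cancel : ∀ A → (1ₚ +ₚ A) -ₚ A ≋ 1ₚ
    cancel = solve-∀ poly-ring

  U-coeff : ∀ i → coeff U i ≡ coeff (remainder m) i ℚ.- c ℚ.* coeff (ones r) i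
  U-coeff i = trans (coeff-- (remainder m) (scaleₚ c (ones r)) i)
    (cong (λ x → coeff (remainder m) i ℚ.- x) (coeff-scale c (ones r) i))

  U-coeff-< : ∀ i → i ℕ.< r → coeff U i ≡ coeff (remainder m) i ℚ.- c
  U-coeff-< i i<r = trans (U-coeff i) (cong (λ x → coeff (remainder m) i ℚ.- x)
    (trans (cong (c ℚ.*_) (Indicator-1 i<r (ones-indicator r i))) (ℚₚ.*-identityʳ c)))

  U-coeff-≥ : ∀ i → r ℕ.≤ i → coeff U i ≡ 0ℚ
  U-coeff-≥ i r≤i = trans (U-coeff i) (cong₂ ℚ._-_
    (Indicator-0 (λ { (j , _ , refl) → ℕₚ.<⇒≱ (ℕ.m%n<n (j ℕ.* p) r) r≤i }) (remainder-m i))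
    (trans (cong (c ℚ.*_) (DegLt-ones r i r≤i)) (ℚₚ.*-zeroʳ c)))

  DegLt-U : DegLt U (r ∸ 1)
  DegLt-U i r-1≤i with ℕₚ.m≤n⇒m<n∨m≡n r-1≤i
  ... | inj₁ r-1<i = U-coeff-≥ i (subst (ℕ._≤ i) (ℕₚ.suc-pred r) r-1<i)
  ... | inj₂ refl = trans (U-coeff-< (r ∸ 1) (ℕₚ.≤-reflexive (ℕₚ.suc-pred r))) (ℚₚ.+-inverseʳ c)

  Indicator-- : ∀ {P Q x y} → Indicator P x → Indicator Q y →
    x ℚ.- y ≡ ℚ.- 1ℚ ⊎ x ℚ.- y ≡ 0ℚ ⊎ x ℚ.- y ≡ 1ℚ
  Indicator-- (inj₁ (_ , refl)) (inj₁ (_ , refl)) = inj₂ (inj₁ refl)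
  Indicator-- (inj₁ (_ , refl)) (inj₂ (_ , refl)) = inj₂ (inj₂ refl)
  Indicator-- (inj₂ (_ , refl)) (inj₁ (_ , refl)) = inj₁ refl
  Indicator-- (inj₂ (_ , refl)) (inj₂ (_ , refl)) = inj₂ (inj₁ refl)

  -- The subtracted constant `c` is itself a coefficient of `remainder m`, so below r each
  -- coefficient is a difference of two indicators.
  U-flat : ∀ i → coeff U i ≡ ℚ.- 1ℚ ⊎ coeff U i ≡ 0ℚ ⊎ coeff U i ≡ 1ℚ
  U-flat i with i ℕ.<? r
  ... | yes i<r rewrite U-coeff-< i i<r = Indicator-- (remainder-m i) (remainder-m (r ∸ 1))
  ... | no i≮r = inj₂ (inj₁ (U-coeff-≥ i (ℕₚ.≮⇒≥ i≮r)))

  is-inverse : IsInvMod p r U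
  is-inverse = DegLt-weaken {U} (φ-prime-≥ r-prime) DegLt-U ,
    inverse-mod U V (Φ-prime p-prime) (Φ-prime r-prime) bezout

-- The inverses that involve Φ_pr

module Φpr-inverses {p r : ℕ} (p-prime : Prime p) (r-prime : Prime r) (p≢r : p ≢ r) where
  private instance
    p≢0 = prime⇒nonZero p-prime
    r≢0 = prime⇒nonZero r-prime

  open Φpr p-prime r-prime p≢r

  -- The definition of `Ψ` is already a Bezout identity between `Ψ` and X - 1; it is read here from
  -- one side and in `Φ1⁻¹-mod-Φpr` from the other.
  Φpr⁻¹-mod-Φ1 : IsInvMod (p ℕ.* r) 1 1ₚ
  Φpr⁻¹-mod-Φ1 = DegLt-const 1ℚ 0 , inverse-mod 1ₚ (-ₚ gaps) Φpr≋Ψ Φ1≋ (rearrange X gaps)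
    where
    rearrange : ∀ X G → (1ₚ +ₚ (X -ₚ 1ₚ) *ₚ G) *ₚ 1ₚ +ₚ (X -ₚ 1ₚ) *ₚ (-ₚ G) ≋ 1ₚ
    rearrange = solve-∀ poly-ring

  Φ1⁻¹-mod-Φpr : IsInvMod 1 (p ℕ.* r) (-ₚ gaps)
  Φ1⁻¹-mod-Φpr = DegLt-neg {gaps} (DegLt-weaken {gaps} (φ-pr-≥ p-prime r-prime) DegLt-gaps) ,
    inverse-mod (-ₚ gaps) 1ₚ Φ1≋ Φpr≋Ψ (rearrange X gaps)
    where
    rearrange : ∀ X G → (X -ₚ 1ₚ) *ₚ (-ₚ G) +ₚ (1ₚ +ₚ (X -ₚ 1ₚ) *ₚ G) *ₚ 1ₚ ≋ 1ₚ
    rearrange = solve-∀ poly-ring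

  -gaps-flat : ∀ i → coeff (-ₚ gaps) i ≡ ℚ.- 1ℚ ⊎ coeff (-ₚ gaps) i ≡ 0ℚ ⊎ coeff (-ₚ gaps) i ≡ 1ℚ
  -gaps-flat i with gaps-indicator i
  ... | inj₁ (_ , e) = inj₁ (trans (coeff-neg gaps i) (cong ℚ.-_ e))
  ... | inj₂ (_ , e) = inj₂ (inj₁ (trans (coeff-neg gaps i) (cong ℚ.-_ e)))

  stack : Poly
  stack = sumₚ (geo p) r

  -- The construction of `Ψ` is not symmetric in p and r. This counterpart of `ones-Ψ` comes from
  -- cancelling X^p - 1 in two factorisations of X^(pr) - 1.
  Ψ-ones : Ψ *ₚ ones r ≋ geo p r
  Ψ-ones = telescope-cancel p _ _ (begin
    (X^ p -ₚ 1ₚ) *ₚ (Ψ *ₚ ones r)                   ≈⟨ *ₚ-cong (ones-telescope p) ≋-refl ⟨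
    ((X -ₚ 1ₚ) *ₚ ones p) *ₚ (Ψ *ₚ ones r)          ≈⟨ rearrange (X -ₚ 1ₚ) (ones p) Ψ (ones r) ⟩
    (((X -ₚ 1ₚ) *ₚ ones r) *ₚ ones p) *ₚ Ψ          ≈⟨ *ₚ-cong (*ₚ-cong (ones-telescope r) ≋-refl) ≋-refl ⟩
    ((X^ r -ₚ 1ₚ) *ₚ ones p) *ₚ Ψ                   ≈⟨ divisors-Ψ ⟩
    X^ (p ℕ.* r) -ₚ 1ₚ                              ≈⟨ geo-telescope p r ⟨
    (X^ p -ₚ 1ₚ) *ₚ geo p r                         ∎)
    where
    open ≋-Reasoning
    rearrange : ∀ M A B C → (M *ₚ A) *ₚ (B *ₚ C) ≋ ((M *ₚ C) *ₚ A) *ₚ B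
    rearrange = solve-∀ poly-ring

  -- Modulo `ones p`, `A` stands in for `ones r` and X^p - 1 vanishes, which leaves the constant of
  -- `geo-stack`. Keeping `A` general serves both every admissible d and the length r mod p.
  bezout : ∀ W {A} → ones r ≋ A +ₚ ones p *ₚ W →
    Ψ *ₚ A +ₚ ones p *ₚ (Ψ *ₚ W -ₚ (X -ₚ 1ₚ) *ₚ stack) ≋ constₚ (ℕ→ℚ r)
  bezout W {A} e = begin
    Ψ *ₚ A +ₚ ones p *ₚ (Ψ *ₚ W -ₚ (X -ₚ 1ₚ) *ₚ stack)
      ≈⟨ rearrange Ψ A (ones p) W (X -ₚ 1ₚ) stack ⟩
    Ψ *ₚ (A +ₚ ones p *ₚ W) -ₚ ((X -ₚ 1ₚ) *ₚ ones p) *ₚ stack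
      ≈⟨ +ₚ-cong (*ₚ-congʳ Ψ e) (-ₚ-cong (*ₚ-cong (≋-sym (ones-telescope p)) ≋-refl)) ⟨
    Ψ *ₚ ones r -ₚ (X^ p -ₚ 1ₚ) *ₚ stack
      ≈⟨ +ₚ-cong (≋-trans Ψ-ones (geo-stack p r)) ≋-refl ⟩
    (constₚ (ℕ→ℚ r) +ₚ (X^ p -ₚ 1ₚ) *ₚ stack) -ₚ (X^ p -ₚ 1ₚ) *ₚ stack
      ≈⟨ cancel (constₚ (ℕ→ℚ r)) ((X^ p -ₚ 1ₚ) *ₚ stack) ⟩
    constₚ (ℕ→ℚ r) ∎
    where
    open ≋-Reasoning
    rearrange : ∀ Y A O W M T → Y *ₚ A +ₚ O *ₚ (Y *ₚ W -ₚ M *ₚ T) ≋ Y *ₚ (A +ₚ O *ₚ W) -ₚ (M *ₚ O) *ₚ T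
    rearrange = solve-∀ poly-ring
    cancel : ∀ C A → (C +ₚ A) -ₚ A ≋ C
    cancel = solve-∀ poly-ring

  Φpr⁻¹-mod-Φp : ∀ d → (+ p) ℤᵈ.∣ (+ d ℤ.- + (r ∸ 1)) →
    InvCong (Φ (p ℕ.* r)) (Φ p) (scaleₚ (recipℕ r) (ones (suc d)))
  Φpr⁻¹-mod-Φp d p∣ = let W , e = reduce in
    inverse-mod _ _ Φpr≋Ψ (Φ-prime p-prime)
      (scaled (ℕ→ℚ r) Ψ (ones p) (ones (suc d)) _ (bezout W e) (recipℕ r) (constₚ-recip r))
    where
    -- Whichever of `ones r` and `ones (suc d)` is shorter gets extended by multiples of `ones p`;
    -- when it is `ones r`, the cofactor is negative.
    reduce : ∃ λ W → ones r ≋ ones (suc d) +ₚ ones p *ₚ W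
    reduce with ℕₚ.≤-total d (r ∸ 1)
    ... | inj₁ d≤r-1 with divides k eq ← subst (p ∣_) (trans (cong ℤ.∣_∣ (trans (ℤₚ.m-n≡m⊖n d (r ∸ 1)) (ℤₚ.⊖-≤ d≤r-1))) (ℤₚ.∣-i∣≡∣i∣ (+ (r ∸ 1 ∸ d)))) p∣ =
      X^ (suc d) *ₚ geo p k , subst (λ n → ones n ≋ ones (suc d) +ₚ ones p *ₚ (X^ (suc d) *ₚ geo p k)) (sym r≡) (ones-+-* (suc d) p k)
      where
      r≡ : r ≡ suc d ℕ.+ p ℕ.* k
      r≡ = trans (sym (ℕₚ.suc-pred r)) (cong suc (trans (sym (ℕₚ.m+[n∸m]≡n d≤r-1)) (cong (d ℕ.+_) (trans eq (ℕₚ.*-comm k p)))))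
    ... | inj₂ r-1≤d with divides k eq ← subst (p ∣_) (cong ℤ.∣_∣ (trans (ℤₚ.m-n≡m⊖n d (r ∸ 1)) (ℤₚ.⊖-≥ r-1≤d))) p∣ =
      -ₚ (X^ r *ₚ geo p k) , ≋-trans (rearrange (ones r) (ones p) (X^ r *ₚ geo p k))
        (+ₚ-cong (≋-sym (subst (λ n → ones n ≋ ones r +ₚ ones p *ₚ (X^ r *ₚ geo p k)) (sym d≡) (ones-+-* r p k))) ≋-refl)
      where
      d≡ : suc d ≡ r ℕ.+ p ℕ.* k
      d≡ = trans (cong suc (trans (sym (ℕₚ.m+[n∸m]≡n r-1≤d)) (cong (r ∸ 1 ℕ.+_) (trans eq (ℕₚ.*-comm k p))))) (cong (ℕ._+ p ℕ.* k) (ℕₚ.suc-pred r))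
      rearrange : ∀ A O W → A ≋ (A +ₚ O *ₚ W) +ₚ O *ₚ (-ₚ W)
      rearrange = solve-∀ poly-ring

  e = r ℕ.% p
  q = r ℕ./ p

  r≡e+pq : r ≡ e ℕ.+ p ℕ.* q
  r≡e+pq = trans (ℕ.m≡m%n+[m/n]*n r p) (cong (e ℕ.+_) (ℕₚ.*-comm q p))

  Z : Poly
  Z = Ψ *ₚ (X^ e *ₚ geo p q) -ₚ (X -ₚ 1ₚ) *ₚ stack

  Z-bezout : Ψ *ₚ ones e +ₚ ones p *ₚ Z ≋ constₚ (ℕ→ℚ r)
  Z-bezout = bezout (X^ e *ₚ geo p q)
    (subst (λ n → ones n ≋ ones e +ₚ ones p *ₚ (X^ e *ₚ geo p q)) (sym r≡e+pq) (ones-+-* e p q))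

  -- The degree is read off after multiplying by X^p - 1: the product is r (X - 1) - (X^e - 1) Ψ, of
  -- degree less than p + φ′ because e < p.
  DegLt-Z : DegLt Z φ′
  DegLt-Z = DegLt-telescope p Z φ′ (DegLt-resp (≋-sym product)
    (DegLt-+ {(X -ₚ 1ₚ) *ₚ C} { -ₚ ((X^ e -ₚ 1ₚ) *ₚ Ψ)}
      (DegLt-weaken {(X -ₚ 1ₚ) *ₚ C} (ℕₚ.≤-trans 1<p (ℕₚ.m≤m+n p φ′)) (DegLt-* {X -ₚ 1ₚ} {C} 1 (DegLt-X^-1 1) (DegLt-const (ℕ→ℚ r) 0)))
      (DegLt-neg {(X^ e -ₚ 1ₚ) *ₚ Ψ} (DegLt-weaken {(X^ e -ₚ 1ₚ) *ₚ Ψ} bound (DegLt-* {X^ e -ₚ 1ₚ} {Ψ} e (DegLt-X^-1 e) DegLt-Ψ)))))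
    where
    C = constₚ (ℕ→ℚ r)
    bound : e ℕ.+ suc φ′ ℕ.≤ p ℕ.+ φ′
    bound = subst (ℕ._≤ p ℕ.+ φ′) (sym (ℕₚ.+-suc e φ′)) (ℕₚ.+-monoˡ-≤ φ′ (ℕ.m%n<n r p))
    product : (X^ p -ₚ 1ₚ) *ₚ Z ≋ (X -ₚ 1ₚ) *ₚ C -ₚ (X^ e -ₚ 1ₚ) *ₚ Ψ
    product = begin
      (X^ p -ₚ 1ₚ) *ₚ Z                                          ≈⟨ *ₚ-cong (ones-telescope p) ≋-refl ⟨
      ((X -ₚ 1ₚ) *ₚ ones p) *ₚ Z                                 ≈⟨ rearrange (X -ₚ 1ₚ) (ones p) Z Ψ (ones e) ⟩
      (X -ₚ 1ₚ) *ₚ (Ψ *ₚ ones e +ₚ ones p *ₚ Z) -ₚ ((X -ₚ 1ₚ) *ₚ ones e) *ₚ Ψ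
        ≈⟨ +ₚ-cong (*ₚ-congʳ (X -ₚ 1ₚ) Z-bezout) (-ₚ-cong (*ₚ-cong (ones-telescope e) ≋-refl)) ⟩
      (X -ₚ 1ₚ) *ₚ C -ₚ (X^ e -ₚ 1ₚ) *ₚ Ψ                        ∎
      where
      open ≋-Reasoning
      rearrange : ∀ M O Z Y A → (M *ₚ O) *ₚ Z ≋ M *ₚ (Y *ₚ A +ₚ O *ₚ Z) -ₚ (M *ₚ A) *ₚ Y
      rearrange = solve-∀ poly-ring

  Ψ-coeff : ∀ i → coeff Ψ i ≡ coeff (1ₚ +ₚ X *ₚ gaps) i ℚ.- coeff gaps i
  Ψ-coeff i = trans (at (rearrange X gaps) i) (coeff-- (1ₚ +ₚ X *ₚ gaps) gaps i)
    where
    rearrange : ∀ X G → 1ₚ +ₚ (X -ₚ 1ₚ) *ₚ G ≋ (1ₚ +ₚ X *ₚ G) -ₚ G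
    rearrange = solve-∀ poly-ring

  -- The constant 1 and the shifted gaps do not overlap.
  1+X*gaps-≲ : ∀ i → coeff (1ₚ +ₚ X *ₚ gaps) i ≲ + 1
  1+X*gaps-≲ zero = ≲-resp (trans (coeff-+ 1ₚ (X *ₚ gaps) 0) (cong (1ℚ ℚ.+_) (X^*-coeff-< 1 gaps 0 (s≤s z≤n))))
    (ℕ→ℚ-≲ {1} ℕₚ.≤-refl)
  1+X*gaps-≲ (suc i) = ≲-resp
    (trans (coeff-+ 1ₚ (X *ₚ gaps) (suc i)) (trans (ℚₚ.+-identityˡ (coeff (X *ₚ gaps) (suc i))) (X^*-coeff 1 gaps i)))
    (Indicator-≲ (gaps-indicator i))

  Ψ-coeff-≲ : ∀ i → coeff Ψ i ≲ + 1
  Ψ-coeff-≲ i = ≲-resp (Ψ-coeff i) (≲-+ (1+X*gaps-≲ i) (-Indicator-≲ (gaps-indicator i)))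

  -- At a gap the subtracted `gaps` contributes -1, which offsets the 1 allowed for the rest of `Ψ`.
  Ψ-coeff-gap : ∀ i → Gap i → coeff Ψ i ≲ + 0
  Ψ-coeff-gap i gap = ≲-resp (Ψ-coeff i) (≲-+ (1+X*gaps-≲ i)
    (≲-resp (cong ℚ.-_ (Indicator-1 gap (gaps-indicator i))) (ℤ.- + 1 , refl , ℤₚ.≤-refl)))

  -- Of -(X - 1) T = T - X T, the second part can only lower a coefficient, since T has natural
  -- coefficients.
  Z-coeff-≲ : ∀ i {b n} → coeff (Ψ *ₚ (X^ e *ₚ geo p q)) i ≲ + b → coeff stack i ≡ ℕ→ℚ n → coeff Z i ≲ + (b ℕ.+ n)
  Z-coeff-≲ i {b} {n} ΨW≲b stack≡n = ≲-resp (trans (at (rearrange X (Ψ *ₚ (X^ e *ₚ geo p q)) stack) i)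
      (trans (coeff-- (Ψ *ₚ (X^ e *ₚ geo p q) +ₚ stack) (X *ₚ stack) i) (cong (ℚ._- coeff (X *ₚ stack) i) (coeff-+ (Ψ *ₚ (X^ e *ₚ geo p q)) stack i))))
    (≲-trans (≲-+ (≲-+ ΨW≲b (≲-resp stack≡n (ℕ→ℚ-≲ {n} ℕₚ.≤-refl))) (shifted i))
      (ℤₚ.≤-reflexive (cong +_ (ℕₚ.+-identityʳ (b ℕ.+ n)))))
    where
    rearrange : ∀ X A T → A -ₚ (X -ₚ 1ₚ) *ₚ T ≋ (A +ₚ T) -ₚ X *ₚ T
    rearrange = solve-∀ poly-ring
    shifted : ∀ i → ℚ.- coeff (X *ₚ stack) i ≲ + 0
    shifted zero = ≲-resp (cong ℚ.-_ (X^*-coeff-< 1 stack 0 (s≤s z≤n))) (-ℕ→ℚ-≲ 0)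
    shifted (suc i) = ≲-resp (cong ℚ.-_ (trans (X^*-coeff 1 stack i) (proj₂ (stack-coeff p r i)))) (-ℕ→ℚ-≲ (proj₁ (stack-coeff p r i)))

  ΨW-≲ : ∀ i → coeff (Ψ *ₚ (X^ e *ₚ geo p q)) i ≲ + q
  ΨW-≲ i = subst (λ n → coeff (Ψ *ₚ (X^ e *ₚ geo p q)) i ≲ + n) (ℕₚ.*-identityʳ q)
    (coeff-*-geo-≲ Ψ e p q 1 i (λ j m _ _ → Ψ-coeff-≲ m))

  -- Here k p - e - j p is congruent to (p - 1) r modulo p and smaller, hence a gap.
  ΨW-≲-gap : ∀ k → k ℕ.+ q ℕ.< r → coeff (Ψ *ₚ (X^ e *ₚ geo p q)) (p ℕ.* k) ≲ + 0
  ΨW-≲-gap k k+q<r = subst (λ n → coeff (Ψ *ₚ (X^ e *ₚ geo p q)) (p ℕ.* k) ≲ + n) (ℕₚ.*-zeroʳ q)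
    (coeff-*-geo-≲ Ψ e p q 0 (p ℕ.* k) (λ j m j<q eq → Ψ-coeff-gap m (gap j m eq)))
    where
    p′ = ℕ.pred p
    pr≡ : p ℕ.* r ≡ r ℕ.+ p′ ℕ.* r
    pr≡ = cong (ℕ._* r) (sym (ℕₚ.suc-pred p))
    gap : ∀ j m → p ℕ.* k ≡ e ℕ.+ p ℕ.* j ℕ.+ m → Gap m
    gap j m eq = p′ , ℕₚ.≤-reflexive (ℕₚ.suc-pred p) , below , residue
      where
      below : m ℕ.< p′ ℕ.* r
      -- Both sides are raised by r = e + p q, so that the hypothesis enters as p (k + q) < p r.
      below = ℕₚ.+-cancelˡ-< (e ℕ.+ p ℕ.* q) m (p′ ℕ.* r) (begin-strict
        e ℕ.+ p ℕ.* q ℕ.+ m                      ≤⟨ ℕₚ.m≤m+n _ (p ℕ.* j) ⟩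
        e ℕ.+ p ℕ.* q ℕ.+ m ℕ.+ p ℕ.* j          ≡⟨ lemma e (p ℕ.* q) m (p ℕ.* j) ⟩
        e ℕ.+ p ℕ.* j ℕ.+ m ℕ.+ p ℕ.* q          ≡⟨ cong (ℕ._+ p ℕ.* q) eq ⟨
        p ℕ.* k ℕ.+ p ℕ.* q                      ≡⟨ ℕₚ.*-distribˡ-+ p k q ⟨
        p ℕ.* (k ℕ.+ q)                          <⟨ ℕₚ.*-monoʳ-< p k+q<r ⟩
        p ℕ.* r                                  ≡⟨ pr≡ ⟩
        r ℕ.+ p′ ℕ.* r                           ≡⟨ cong (ℕ._+ p′ ℕ.* r) r≡e+pq ⟩
        e ℕ.+ p ℕ.* q ℕ.+ p′ ℕ.* r               ∎)
        where
        open ℕₚ.≤-Reasoning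
        lemma : ∀ a b c d → a ℕ.+ b ℕ.+ c ℕ.+ d ≡ a ℕ.+ d ℕ.+ c ℕ.+ b
        lemma = ℕ-solve-∀
      -- To avoid subtraction, multiples of p are added on both sides until the two numbers agree.
      residue : m ℕ.% p ≡ (p′ ℕ.* r) ℕ.% p
      residue = begin
        m ℕ.% p                                                  ≡⟨ ℕ.[m+kn]%n≡m%n m (r ℕ.+ j) p ⟨
        (m ℕ.+ (r ℕ.+ j) ℕ.* p) ℕ.% p                            ≡⟨ cong (ℕ._% p) same ⟩
        (p′ ℕ.* r ℕ.+ (k ℕ.+ q) ℕ.* p) ℕ.% p                     ≡⟨ ℕ.[m+kn]%n≡m%n (p′ ℕ.* r) (k ℕ.+ q) p ⟩
        (p′ ℕ.* r) ℕ.% p                                         ∎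
        where
        open ≡-Reasoning
        expand : ∀ m r j p → m ℕ.+ (r ℕ.+ j) ℕ.* p ≡ p ℕ.* r ℕ.+ (m ℕ.+ p ℕ.* j)
        expand = ℕ-solve-∀
        regroup : ∀ e pq a m pj → (e ℕ.+ pq ℕ.+ a) ℕ.+ (m ℕ.+ pj) ≡ a ℕ.+ ((e ℕ.+ pj ℕ.+ m) ℕ.+ pq)
        regroup = ℕ-solve-∀
        contract : ∀ a p k q → a ℕ.+ (p ℕ.* k ℕ.+ p ℕ.* q) ≡ a ℕ.+ (k ℕ.+ q) ℕ.* p
        contract = ℕ-solve-∀
        same : m ℕ.+ (r ℕ.+ j) ℕ.* p ≡ p′ ℕ.* r ℕ.+ (k ℕ.+ q) ℕ.* p
        same = begin
          m ℕ.+ (r ℕ.+ j) ℕ.* p                                          ≡⟨ expand m r j p ⟩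
          p ℕ.* r ℕ.+ (m ℕ.+ p ℕ.* j)                                    ≡⟨ cong (ℕ._+ (m ℕ.+ p ℕ.* j)) (trans pr≡ (cong (ℕ._+ p′ ℕ.* r) r≡e+pq)) ⟩
          (e ℕ.+ p ℕ.* q ℕ.+ p′ ℕ.* r) ℕ.+ (m ℕ.+ p ℕ.* j)               ≡⟨ regroup e (p ℕ.* q) (p′ ℕ.* r) m (p ℕ.* j) ⟩
          p′ ℕ.* r ℕ.+ ((e ℕ.+ p ℕ.* j ℕ.+ m) ℕ.+ p ℕ.* q)               ≡⟨ cong (λ x → p′ ℕ.* r ℕ.+ (x ℕ.+ p ℕ.* q)) eq ⟨
          p′ ℕ.* r ℕ.+ (p ℕ.* k ℕ.+ p ℕ.* q)                             ≡⟨ contract (p′ ℕ.* r) p k q ⟩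
          p′ ℕ.* r ℕ.+ (k ℕ.+ q) ℕ.* p                                   ∎

  -- Since p is at least 2, 2 q ≤ p q; strictness comes from the remainder e, nonzero because p does
  -- not divide r.
  q+q<r : q ℕ.+ q ℕ.< r
  q+q<r = begin-strict
    q ℕ.+ q                ≡⟨ cong (q ℕ.+_) (ℕₚ.+-identityʳ q) ⟨
    2 ℕ.* q                ≤⟨ ℕₚ.*-monoˡ-≤ q 1<p ⟩
    p ℕ.* q                <⟨ ℕₚ.m<n+m (p ℕ.* q) (ℕₚ.n≢0⇒n>0 (distinct-primes-∤ p-prime r-prime p≢r ∘ m%n≡0⇒n∣m r p)) ⟩
    e ℕ.+ p ℕ.* q          ≡⟨ r≡e+pq ⟨
    r                      ∎
    where open ℕₚ.≤-Reasoning

  stack-coeff-∣-r : ∀ k → coeff stack (p ℕ.* k) ≡ ℕ→ℚ (r ∸ 1 ∸ k)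
  stack-coeff-∣-r k = trans (cong (λ n → coeff (sumₚ (geo p) n) (p ℕ.* k)) (sym (ℕₚ.suc-pred r))) (stack-coeff-∣ p (r ∸ 1) k)

  -- The two contributions are never large together. Off the multiples of p only the q copies of `Ψ`
  -- count. At p k the stack gives r - 1 - k: if k + q < r the copies add nothing positive, and
  -- otherwise the stack gives at most q, so the total is at most 2 q.
  Z-bound : ∀ i → ∃ λ b → coeff Z i ≲ + b × b ℕ.< r
  Z-bound i = cases (p ∣? i)
    where
    multiple : ∀ k → Dec (k ℕ.+ q ℕ.< r) → ∃ λ b → coeff Z (p ℕ.* k) ≲ + b × b ℕ.< r
    multiple k (yes k+q<r) = r ∸ 1 ∸ k , Z-coeff-≲ (p ℕ.* k) (ΨW-≲-gap k k+q<r) (stack-coeff-∣-r k) ,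
      ℕₚ.≤-<-trans (ℕₚ.m∸n≤m (r ∸ 1) k) (ℕₚ.≤-reflexive (ℕₚ.suc-pred r))
    multiple k (no k+q≮r) = q ℕ.+ (r ∸ 1 ∸ k) , Z-coeff-≲ (p ℕ.* k) (ΨW-≲ (p ℕ.* k)) (stack-coeff-∣-r k) ,
      ℕₚ.≤-<-trans (ℕₚ.+-monoʳ-≤ q (ℕₚ.≤-trans (ℕₚ.∸-monoˡ-≤ k (ℕₚ.m∸n≤m r 1)) (ℕₚ.m≤n+o⇒m∸n≤o r k (ℕₚ.≮⇒≥ k+q≮r)))) q+q<r
    cases : Dec (p ∣ i) → ∃ λ b → coeff Z i ≲ + b × b ℕ.< r
    cases (no p∤i) = q ℕ.+ 0 , Z-coeff-≲ i (ΨW-≲ i) (stack-coeff-∤ p r i p∤i) ,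
      ℕₚ.≤-<-trans (ℕₚ.+-monoʳ-≤ q z≤n) q+q<r
    cases (yes (divides k i≡kp)) = subst (λ j → ∃ λ b → coeff Z j ≲ + b × b ℕ.< r)
      (trans (ℕₚ.*-comm p k) (sym i≡kp)) (multiple k (k ℕ.+ q ℕ.<? r))

  Φp⁻¹-mod-Φpr : IsInvMod p (p ℕ.* r) (scaleₚ (recipℕ r) Z)
  Φp⁻¹-mod-Φpr = DegLt-scale (recipℕ r) {Z} (DegLt-weaken {Z} (φ-pr-≥ p-prime r-prime) DegLt-Z) ,
    inverse-mod _ (scaleₚ (recipℕ r) (ones e)) (Φ-prime p-prime) Φpr≋Ψ
      (scaled (ℕ→ℚ r) (ones p) Ψ Z (ones e) (≋-trans (+ₚ-comm (ones p *ₚ Z) (Ψ *ₚ ones e)) Z-bezout) (recipℕ r) (constₚ-recip r))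

  Z/r-coeff : ∀ i → ∃ λ (v : ℤ) → coeff (scaleₚ (recipℕ r) Z) i ≡ recipℕ r ℚ.* ℤ→ℚ v × v ℤ.< + r
  Z/r-coeff i = let b , (v , eq , v≤b) , b<r = Z-bound i in
    v , trans (coeff-scale (recipℕ r) Z i) (cong (recipℕ r ℚ.*_) eq) , ℤₚ.≤-<-trans v≤b (ℤ.+<+ b<r)

theorem1 : (p r : ℕ) → Prime p → Prime r → p ≢ r →
    ( IsInvMod p 1 (constₚ (recipℕ p))
    × IsInvMod 1 p
    (scaleₚ (ℚ.- recipℕ p) (map (λ k → ℕ→ℚ (p ∸ 1 ∸ k)) (upTo (p ∸ 1)))) )
    × ( IsInvMod (p * r) 1 1ₚ
    × ∃ λ U → IsInvMod 1 (p * r) U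
    × (∀ i → coeff U i ≡ ℚ.- 1ℚ ⊎ coeff U i ≡ 0ℚ ⊎ coeff U i ≡ 1ℚ) )
    × ( (∀ (d : ℕ) → (+ p) ℤᵈ.∣ (+ d ℤ.- + (r ∸ 1)) →
    InvCong (Φ (p * r)) (Φ p) (scaleₚ (recipℕ r) (replicate (suc d) 1ℚ)))
    × ∃ λ U → IsInvMod p (p * r) U
    × (∀ i → ∃ λ (v : ℤ) → coeff U i ≡ recipℕ r ℚ.* ℤ→ℚ v × v ℤ.< + r) )
    × ( ∃ λ U → IsInvMod p r U
    × (∀ i → coeff U i ≡ ℚ.- 1ℚ ⊎ coeff U i ≡ 0ℚ ⊎ coeff U i ≡ 1ℚ) )
theorem1 p r p-prime r-prime p≢r =
  (Φp⁻¹-mod-Φ1 p-prime , Φ1⁻¹-mod-Φp p-prime) ,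
  (Φpr⁻¹-mod-Φ1 , -ₚ gaps , Φ1⁻¹-mod-Φpr , -gaps-flat) ,
  (Φpr⁻¹-mod-Φp , scaleₚ (recipℕ r) Z , Φp⁻¹-mod-Φpr , Z/r-coeff) ,
  (U , is-inverse , U-flat)
  where
  open Φpr p-prime r-prime p≢r using (gaps)
  open Φpr-inverses p-prime r-prime p≢r
  open Φp-mod-Φr p-prime r-prime p≢r using (U; is-inverse; U-flat)
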